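{- Let $\mathcal L$ be a coherent differential resource category which is closed (as a symmetric monoidal category) and Scott. Let $f\in\mathcal L_!(Z\mathbin{\&}X,\ Y\Rightarrow Y)$. Then, in $\mathcal L_!(Z\mathbin{\&}\mathbf DX,\ \mathbf DY)$, $$\mathbf D_2(\mathsf{fix}(f))=\mathsf{fix}\big((\mathbf DY\Rightarrow\theta_Y)\circ \mathcal D\circ\psi_{Y,Y}\circ\mathbf D_2f\big).$$
   Context: **Summability.** $\mathcal L$ has zero-morphisms $0_{X,Y}$ (absorbing for composition; $0\otimes f=0$, $f\otimes 0=0$). A summability structure is $(\mathbf S,\pi_0,\pi_1,\sigma)$ with $\mathbf S:\mathcal L\to\mathcal L$ a functor and $\pi_0,\pi_1,\sigma$ natural in $\mathcal L(\mathbf SX,X)$, $\pi_0,\pi_1$ jointly monic. $f_0,f_1\in\mathcal L(Y,X)$ are summable if there is a (unique) $h=\langle\!\langle f_0,f_1\rangle\!\rangle\in\mathcal L(Y,\mathbf SX)$ with $\pi_ih=f_i$; then $f_0+f_1:=\sigma h$. Axioms: $\pi_1,\pi_0$ are summable with sum $\sigma$; $0_{X,X},\mathrm{Id}_X$ are summable with sum $\mathrm{Id}_X$; if $f_0,f_1\in\mathcal L(X,\mathbf SY)$ and $\sigma f_0,\sigma f_1$ are summable, then $f_0,f_1$ are summable. Derived natural morphisms: $\iota_0=\langle\!\langle\mathrm{Id},0\rangle\!\rangle:X\to\mathbf SX$; $\iota_1=\langle\!\langle 0,\mathrm{Id}\rangle\!\rangle$; $\theta_X:\mathbf S^2X\to\mathbf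 SX$ with $\pi_0\theta=\pi_0\pi_0$, $\pi_1\theta=\pi_0\pi_1+\pi_1\pi_0$; the flip $c_X:\mathbf S^2X\to\mathbf S^2X$ with $\pi_i\pi_jc=\pi_j\pi_i$; the lift $l_X:\mathbf SX\to\mathbf S^2X$ with $\pi_i\pi_il=\pi_i$, $\pi_i\pi_{1-i}l=0$. **Resource category.** $\mathcal L$ is a symmetric monoidal category (SMC) $(\mathcal L,1,\otimes)$ with zero-morphisms, with finite products ($\top$, $\&$, projections $p_i$), and a resource modality: a comonad $(!,\mathsf{der},\mathsf{dig})$ with Seely isos $m^0:1\to!\top$ and $m^2_{X_1,X_2}:{!X_1}\otimes{!X_2}\to{!(X_1\&X_2)}$ making it a strong symmetric monoidal comonad from $(\mathcal L,\top,\&)$ to $(\mathcal L,1,\otimes)$. The Kleisli category $\mathcal L_!$ has $\mathcal L_!(X,Y)=\mathcal L(!X,Y)$, composition $g\circ f=g\,(!f)\,\mathsf{dig}$; $\mathsf{Der}:\mathcal L\to\mathcal L_!$, $\mathsf{Der}(f)=f\,\mathsf{der}_X$. **Compatibility axioms.** ($\mathbf S$-$\otimes$) if $f_0,f_1$ are summable then so are $f_0\otimes g,f_1\otimes g$, and $(f_0+f_1)\otimes g=f_0\otimes g+f_1\otimes g$. ($\mathbf S$-$\&$) $\langle\mathbf Sp_i\rangle_{i\in I}:\mathbf S(\&_iX_i)\to\&_i\mathbf SX_i$ is an iso for every finite family; its inverse is denoted $\kappa$. By ($\mathbf S$-$\otimes$) there are $\varphi^1_{X_1,X_2}=\langle\!\langle\pi_0\otimes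 X_2,\pi_1\otimes X_2\rangle\!\rangle:\mathbf SX_1\otimes X_2\to\mathbf S(X_1\otimes X_2)$ and $L_{X_1,X_2}:\mathbf SX_1\otimes\mathbf SX_2\to\mathbf S(X_1\otimes X_2)$ with $\pi_0L=\pi_0\otimes\pi_0$, $\pi_1L=\pi_1\otimes\pi_0+\pi_0\otimes\pi_1$. ($\mathbf S$-$\multimap$), assumed when the SMC is closed with internal hom $(X\multimap Y,\mathsf{ev})$ and currying $\mathsf{cur}$: the morphism $\varphi^{\multimap}_{X,Y}=\mathsf{cur}((\mathbf S\,\mathsf{ev})\,\varphi^1_{X\multimap Y,X})\in\mathcal L(\mathbf S(X\multimap Y),X\multimap\mathbf SY)$ is an iso. **Differential structure.** A natural $\partial_X\in\mathcal L(!\mathbf SX,\mathbf S!X)$ with: (chain) $(\mathbf S\mathsf{der}_X)\partial_X=\mathsf{der}_{\mathbf SX}$ and $(\mathbf S\mathsf{dig}_X)\partial_X=\partial_{!X}(!\partial_X)\mathsf{dig}_{\mathbf SX}$; (local) $\pi_0\partial_X={!\pi_0}$; (add) $\partial_X(!\iota_0)=\iota_0$ and $\partial_X(!\theta_X)=\theta_{!X}(\mathbf S\partial_X)\partial_{\mathbf SX}$; ($\&$) $\partial_\top(!0)m^0=(\mathbf Sm^0)\iota_0$ and $\partial_{X_1\&X_2}(!\kappa)m^2_{\mathbf SX_1,\mathbf SX_2}=(\mathbf Sm^2_{X_1,X_2})L_{!X_1,!X_2}(\partial_{X_1}\otimes\partial_{X_2})$; (Schwarz) $c_{!X}(\mathbf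 S\partial_X)\partial_{\mathbf SX}=(\mathbf S\partial_X)\partial_{\mathbf SX}(!c_X)$; (lift) $l_{!X}\partial_X=(\mathbf S\partial_X)\partial_{\mathbf SX}(!l_X)$. A coherent differential resource category is a resource category with a summability structure satisfying ($\mathbf S$-$\otimes$), ($\mathbf S$-$\&$) (and ($\mathbf S$-$\multimap$) if closed) and such a $\partial$. **Induced structure on $\mathcal L_!$.** $\mathbf D:\mathcal L_!\to\mathcal L_!$ is the functor $\mathbf DX=\mathbf SX$, $\mathbf Df=(\mathbf Sf)\partial_X$; it is a monad with unit $\mathsf{Der}(\iota_0)$ and multiplication $\mathsf{Der}(\theta)$, also written $\theta_X\in\mathcal L_!(\mathbf D^2X,\mathbf DX)$. Let $\psi^2_{X_1,X_2}=\mathsf{Der}(\kappa_{X_1,X_2}(\iota_0\mathbin{\&}\mathbf SX_2))\in\mathcal L_!(X_1\&\mathbf DX_2,\mathbf D(X_1\&X_2))$. For $f\in\mathcal L_!(X_1\&X_2,Y)$, $\mathbf D_2f=\mathbf Df\circ\psi^2_{X_1,X_2}\in\mathcal L_!(X_1\&\mathbf DX_2,\mathbf DY)$. $\mathcal L_!$ is cartesian closed with $X\Rightarrow Y={!X}\multimap Y$, evaluation $\mathsf{Ev}\in\mathcal L_!((X\Rightarrow Y)\&X,Y)$ and currying $\mathsf{Cur}$. Set $\mathcal D=\mathsf{Cur}(\mathbf D\mathsf{Ev}\circ\psi^2_{X\Rightarrow Y,X})\in\mathcal L_!(X\Rightarrow Y,\mathbf DX\Rightarrow\mathbf DY)$ and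 $\psi_{Y,U}=\mathsf{Der}(\varphi^{\multimap}_{!Y,U})\in\mathcal L_!(\mathbf D(Y\Rightarrow U),Y\Rightarrow\mathbf DU)$. In the claim, $\mathcal D\in\mathcal L_!(Y\Rightarrow\mathbf DY,\mathbf DY\Rightarrow\mathbf D^2Y)$ and $\mathbf DY\Rightarrow\theta_Y\in\mathcal L_!(\mathbf DY\Rightarrow\mathbf D^2Y,\mathbf DY\Rightarrow\mathbf DY)$ is the functorial action of the internal hom of $\mathcal L_!$. **Scott.** For $f,g\in\mathcal L(X,Y)$, $f\le g$ means there is $h$ with $f,h$ summable and $g=f+h$. $\mathcal L$ is Scott if $\le$ is an order relation on every hom-set, every monotone sequence in a hom-set has a lub, composition and $\otimes$ commute with lubs of monotone sequences, and the functor $!$ is monotone and commutes with lubs of monotone sequences on hom-sets. **Fixpoints.** For $f\in\mathcal L_!(W,Y\Rightarrow Y)$, $\mathsf{fix}(f)\in\mathcal L_!(W,Y)$ is the least $g$ with $\mathsf{Ev}\circ\langle f,g\rangle=g$; it equals $\sup_n\mathsf{fix}_n(f)$ where $\mathsf{fix}_0(f)=0$ and $\mathsf{fix}_{n+1}(f)=\mathsf{Ev}\circ\langle f,\mathsf{fix}_n(f)\rangle$. -}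

module Defs where

open import Level using (Level; _⊔_) renaming (suc to lsuc)
open import Data.Nat using (ℕ; zero; suc; z≤n; s≤s) renaming (_≤_ to _≤ℕ_)
open import Data.Nat.Properties using (n≤1+n)
open import Data.Product using (Σ-syntax; _,_; proj₁; proj₂)
open import Relation.Binary.Bundles using (Setoid)
open import Relation.Binary.Definitions using (Monotonic₁)
open import Relation.Binary.Structures using (IsEquivalence; IsPartialOrder)
import Relation.Binary.Reasoning.Setoid as SetoidReasoning

private
  variable
    o ℓ e : Level

record Category (o ℓ e : Level) : Set (lsuc (o ⊔ ℓ ⊔ e)) where
  infix  4 _≈_ _⟶_
  infixr 9 _∘_
  field
    Obj : Set o
    _⟶_ : Obj → Obj → Set ℓ
    _≈_ : ∀ {X Y} → X ⟶ Y → X ⟶ Y → Set e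
    id  : ∀ {X} → X ⟶ X
    _∘_ : ∀ {X Y Z} → Y ⟶ Z → X ⟶ Y → X ⟶ Z

    isEquivalence : ∀ {X Y} → IsEquivalence (_≈_ {X} {Y})
    ∘-cong    : ∀ {X Y Z} {g g′ : Y ⟶ Z} {f f′ : X ⟶ Y} →
                g ≈ g′ → f ≈ f′ → g ∘ f ≈ g′ ∘ f′
    assoc     : ∀ {W X Y Z} {h : Y ⟶ Z} {g : X ⟶ Y} {f : W ⟶ X} →
                (h ∘ g) ∘ f ≈ h ∘ (g ∘ f)
    identityˡ : ∀ {X Y} {f : X ⟶ Y} → id ∘ f ≈ f
    identityʳ : ∀ {X Y} {f : X ⟶ Y} → f ∘ id ≈ f

  hom-setoid : ∀ (X Y : Obj) → Setoid ℓ e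
  hom-setoid X Y = record { Carrier = X ⟶ Y ; _≈_ = _≈_ ; isEquivalence = isEquivalence }

  record IsIso {X Y : Obj} (f : X ⟶ Y) : Set (ℓ ⊔ e) where
    field
      inv  : Y ⟶ X
      invˡ : inv ∘ f ≈ id
      invʳ : f ∘ inv ≈ id

module CategoryProperties (C : Category o ℓ e) where
  open Category C

  module _ {X Y : Obj} where
    open IsEquivalence (isEquivalence {X} {Y}) public
      using () renaming (refl to ≈-refl; sym to ≈-sym; trans to ≈-trans)
    open SetoidReasoning (hom-setoid X Y) public

  ∘-congˡ : ∀ {X Y Z} {g : Y ⟶ Z} {f f′ : X ⟶ Y} → f ≈ f′ → g ∘ f ≈ g ∘ f′
  ∘-congˡ = ∘-cong ≈-refl

  ∘-congʳ : ∀ {X Y Z} {g g′ : Y ⟶ Z} {f : X ⟶ Y} → g ≈ g′ → g ∘ f ≈ g′ ∘ f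
  ∘-congʳ p = ∘-cong p ≈-refl

  pullˡ : ∀ {W X Y Z} {h : Y ⟶ Z} {g : X ⟶ Y} {k : X ⟶ Z} {f : W ⟶ X} →
          h ∘ g ≈ k → h ∘ (g ∘ f) ≈ k ∘ f
  pullˡ p = ≈-trans (≈-sym assoc) (∘-congʳ p)

  glue : ∀ {V W X Y Z} {h : Y ⟶ Z} {g : X ⟶ Y} {h′ : W ⟶ Z} {g′ : X ⟶ W} {f : V ⟶ X} →
         h ∘ g ≈ h′ ∘ g′ → h ∘ (g ∘ f) ≈ h′ ∘ (g′ ∘ f)
  glue p = ≈-trans (pullˡ p) assoc

record Endofunctor (C : Category o ℓ e) : Set (o ⊔ ℓ ⊔ e) where
  open Category C
  field
    F₀     : Obj → Obj
    F₁     : ∀ {X Y} → X ⟶ Y → F₀ X ⟶ F₀ Y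
    F-cong : ∀ {X Y} {f g : X ⟶ Y} → f ≈ g → F₁ f ≈ F₁ g
    F-id   : ∀ {X} → F₁ (id {X}) ≈ id
    F-∘    : ∀ {X Y Z} {g : Y ⟶ Z} {f : X ⟶ Y} → F₁ (g ∘ f) ≈ F₁ g ∘ F₁ f

record SymmetricMonoidal (C : Category o ℓ e) : Set (o ⊔ ℓ ⊔ e) where
  open Category C
  infixr 10 _⊗_ _⊗₁_
  field
    𝟙    : Obj
    _⊗_  : Obj → Obj → Obj
    _⊗₁_ : ∀ {X X′ Y Y′} → X ⟶ X′ → Y ⟶ Y′ → X ⊗ Y ⟶ X′ ⊗ Y′

    ⊗-cong : ∀ {X X′ Y Y′} {f f′ : X ⟶ X′} {g g′ : Y ⟶ Y′} →
             f ≈ f′ → g ≈ g′ → f ⊗₁ g ≈ f′ ⊗₁ g′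
    ⊗-id   : ∀ {X Y} → id {X} ⊗₁ id {Y} ≈ id
    ⊗-∘    : ∀ {X X′ X″ Y Y′ Y″}
             {f′ : X′ ⟶ X″} {f : X ⟶ X′} {g′ : Y′ ⟶ Y″} {g : Y ⟶ Y′} →
             (f′ ∘ f) ⊗₁ (g′ ∘ g) ≈ (f′ ⊗₁ g′) ∘ (f ⊗₁ g)

    α  : ∀ {X Y Z} → (X ⊗ Y) ⊗ Z ⟶ X ⊗ (Y ⊗ Z)
    λ⊗ : ∀ {X} → 𝟙 ⊗ X ⟶ X
    ρ⊗ : ∀ {X} → X ⊗ 𝟙 ⟶ X
    γ  : ∀ {X Y} → X ⊗ Y ⟶ Y ⊗ X

    α-iso  : ∀ {X Y Z} → IsIso (α {X} {Y} {Z})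
    λ⊗-iso : ∀ {X} → IsIso (λ⊗ {X})
    ρ⊗-iso : ∀ {X} → IsIso (ρ⊗ {X})

    α-natural  : ∀ {X X′ Y Y′ Z Z′} {f : X ⟶ X′} {g : Y ⟶ Y′} {h : Z ⟶ Z′} →
                 α ∘ ((f ⊗₁ g) ⊗₁ h) ≈ (f ⊗₁ (g ⊗₁ h)) ∘ α
    λ⊗-natural : ∀ {X X′} {f : X ⟶ X′} → λ⊗ ∘ (id ⊗₁ f) ≈ f ∘ λ⊗
    ρ⊗-natural : ∀ {X X′} {f : X ⟶ X′} → ρ⊗ ∘ (f ⊗₁ id) ≈ f ∘ ρ⊗
    γ-natural  : ∀ {X X′ Y Y′} {f : X ⟶ X′} {g : Y ⟶ Y′} →
                 γ ∘ (f ⊗₁ g) ≈ (g ⊗₁ f) ∘ γ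

    pentagon : ∀ {W X Y Z} →
               (id {W} ⊗₁ α {X} {Y} {Z}) ∘ α {W} {X ⊗ Y} {Z} ∘ (α {W} {X} {Y} ⊗₁ id {Z})
               ≈ α {W} {X} {Y ⊗ Z} ∘ α {W ⊗ X} {Y} {Z}
    triangle : ∀ {X Y} → (id {X} ⊗₁ λ⊗ {Y}) ∘ α {X} {𝟙} {Y} ≈ ρ⊗ {X} ⊗₁ id {Y}
    hexagon  : ∀ {X Y Z} →
               α {Y} {Z} {X} ∘ γ {X} {Y ⊗ Z} ∘ α {X} {Y} {Z}
               ≈ (id {Y} ⊗₁ γ {X} {Z}) ∘ α {Y} {X} {Z} ∘ (γ {X} {Y} ⊗₁ id {Z})
    γ-involutive : ∀ {X Y} → γ {Y} {X} ∘ γ {X} {Y} ≈ id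

record Closed {C : Category o ℓ e} (M : SymmetricMonoidal C) : Set (o ⊔ ℓ ⊔ e) where
  open Category C
  open SymmetricMonoidal M
  infixr 8 _⊸_
  field
    _⊸_ : Obj → Obj → Obj
    ev  : ∀ {X Y} → (X ⊸ Y) ⊗ X ⟶ Y
    cur : ∀ {X Y Z} → Z ⊗ X ⟶ Y → Z ⟶ X ⊸ Y
    cur-β      : ∀ {X Y Z} {f : Z ⊗ X ⟶ Y} → ev ∘ (cur f ⊗₁ id) ≈ f
    cur-unique : ∀ {X Y Z} {f : Z ⊗ X ⟶ Y} {g : Z ⟶ X ⊸ Y} →
                 ev ∘ (g ⊗₁ id) ≈ f → g ≈ cur f

record FiniteProducts (C : Category o ℓ e) : Set (o ⊔ ℓ ⊔ e) where
  open Category C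
  infixr 10 _&_ _&₁_
  field
    ⊤   : Obj
    !⊤  : ∀ {X} → X ⟶ ⊤
    !⊤-unique : ∀ {X} {f : X ⟶ ⊤} → f ≈ !⊤

    _&_ : Obj → Obj → Obj
    p₁  : ∀ {X Y} → X & Y ⟶ X
    p₂  : ∀ {X Y} → X & Y ⟶ Y
    ⟨_,_⟩ : ∀ {X Y Z} → Z ⟶ X → Z ⟶ Y → Z ⟶ X & Y
    p₁-⟨⟩ : ∀ {X Y Z} {f : Z ⟶ X} {g : Z ⟶ Y} → p₁ ∘ ⟨ f , g ⟩ ≈ f
    p₂-⟨⟩ : ∀ {X Y Z} {f : Z ⟶ X} {g : Z ⟶ Y} → p₂ ∘ ⟨ f , g ⟩ ≈ g
    ⟨⟩-unique : ∀ {X Y Z} {f : Z ⟶ X} {g : Z ⟶ Y} {h : Z ⟶ X & Y} →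
                p₁ ∘ h ≈ f → p₂ ∘ h ≈ g → h ≈ ⟨ f , g ⟩

  _&₁_ : ∀ {X X′ Y Y′} → X ⟶ X′ → Y ⟶ Y′ → X & Y ⟶ X′ & Y′
  f &₁ g = ⟨ f ∘ p₁ , g ∘ p₂ ⟩

  assoc& : ∀ {X Y Z} → (X & Y) & Z ⟶ X & (Y & Z)
  assoc& = ⟨ p₁ ∘ p₁ , ⟨ p₂ ∘ p₁ , p₂ ⟩ ⟩

  swap& : ∀ {X Y} → X & Y ⟶ Y & X
  swap& = ⟨ p₂ , p₁ ⟩

record ZeroMorphisms {C : Category o ℓ e} (M : SymmetricMonoidal C) : Set (o ⊔ ℓ ⊔ e) where
  open Category C
  open SymmetricMonoidal M
  field
    0⟶ : ∀ {X Y} → X ⟶ Y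
    0-∘ : ∀ {X Y Z} {f : X ⟶ Y} → 0⟶ {Y} {Z} ∘ f ≈ 0⟶
    ∘-0 : ∀ {X Y Z} {f : Y ⟶ Z} → f ∘ 0⟶ {X} {Y} ≈ 0⟶
    0-⊗ : ∀ {X X′ Y Y′} {f : Y ⟶ Y′} → 0⟶ {X} {X′} ⊗₁ f ≈ 0⟶
    ⊗-0 : ∀ {X X′ Y Y′} {f : X ⟶ X′} → f ⊗₁ 0⟶ {Y} {Y′} ≈ 0⟶

record Comonad (C : Category o ℓ e) : Set (o ⊔ ℓ ⊔ e) where
  open Category C
  field
    !-functor : Endofunctor C
  open Endofunctor !-functor public
    renaming (F₀ to !₀; F₁ to !₁; F-cong to !-cong; F-id to !-id; F-∘ to !-∘)
  field
    der : ∀ {X} → !₀ X ⟶ X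
    dig : ∀ {X} → !₀ X ⟶ !₀ (!₀ X)
    der-natural : ∀ {X Y} {f : X ⟶ Y} → der ∘ !₁ f ≈ f ∘ der
    dig-natural : ∀ {X Y} {f : X ⟶ Y} → dig ∘ !₁ f ≈ !₁ (!₁ f) ∘ dig
    der-dig     : ∀ {X} → der { !₀ X} ∘ dig ≈ id
    !der-dig    : ∀ {X} → !₁ (der {X}) ∘ dig ≈ id
    dig-dig     : ∀ {X} → dig { !₀ X} ∘ dig ≈ !₁ (dig {X}) ∘ dig

record ResourceModality {C : Category o ℓ e}
                        (M : SymmetricMonoidal C) (P : FiniteProducts C) : Set (o ⊔ ℓ ⊔ e) where
  open Category C
  open SymmetricMonoidal M
  open FiniteProducts P
  field
    !-comonad : Comonad C
  open Comonad !-comonad public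
  field
    m⁰ : 𝟙 ⟶ !₀ ⊤
    m² : ∀ {X Y} → !₀ X ⊗ !₀ Y ⟶ !₀ (X & Y)
    m⁰-iso : IsIso m⁰
    m²-iso : ∀ {X Y} → IsIso (m² {X} {Y})
    m²-natural : ∀ {X X′ Y Y′} {f : X ⟶ X′} {g : Y ⟶ Y′} →
                 m² ∘ (!₁ f ⊗₁ !₁ g) ≈ !₁ (f &₁ g) ∘ m²

    m²-assoc : ∀ {X Y Z} →
               !₁ assoc& ∘ m² {X & Y} {Z} ∘ (m² {X} {Y} ⊗₁ id)
               ≈ m² {X} {Y & Z} ∘ (id ⊗₁ m² {Y} {Z}) ∘ α
    m-unitˡ  : ∀ {X} → !₁ p₂ ∘ m² {⊤} {X} ∘ (m⁰ ⊗₁ id) ≈ λ⊗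
    m-unitʳ  : ∀ {X} → !₁ p₁ ∘ m² {X} {⊤} ∘ (id ⊗₁ m⁰) ≈ ρ⊗
    m²-sym   : ∀ {X Y} → m² {Y} {X} ∘ γ ≈ !₁ swap& ∘ m² {X} {Y}

    -- Compatibility with dig.  Its nullary counterpart !₁ !⊤ ∘ dig ∘ m⁰ ≈ m⁰
    -- is automatic, since !⊤ ≈ der.
    m²-dig   : ∀ {X Y} →
               !₁ ⟨ !₁ p₁ , !₁ p₂ ⟩ ∘ dig ∘ m² {X} {Y} ≈ m² ∘ (dig ⊗₁ dig)

record ResourceCategory (o ℓ e : Level) : Set (lsuc (o ⊔ ℓ ⊔ e)) where
  field
    category         : Category o ℓ e
    monoidal         : SymmetricMonoidal category
    zeroMorphisms    : ZeroMorphisms monoidal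
    products         : FiniteProducts category
    resourceModality : ResourceModality monoidal products

record PreSummabilityStructure (C : Category o ℓ e) : Set (o ⊔ ℓ ⊔ e) where
  open Category C
  field
    S-functor : Endofunctor C
  open Endofunctor S-functor public
    renaming (F₀ to S₀; F₁ to S₁; F-cong to S-cong; F-id to S-id; F-∘ to S-∘)
  field
    π₀ π₁ σ : ∀ {X} → S₀ X ⟶ X
    π₀-natural : ∀ {X Y} {f : X ⟶ Y} → π₀ ∘ S₁ f ≈ f ∘ π₀
    π₁-natural : ∀ {X Y} {f : X ⟶ Y} → π₁ ∘ S₁ f ≈ f ∘ π₁
    σ-natural  : ∀ {X Y} {f : X ⟶ Y} → σ ∘ S₁ f ≈ f ∘ σ
    π-jointly-monic : ∀ {X Y} {h k : Y ⟶ S₀ X} → π₀ ∘ h ≈ π₀ ∘ k → π₁ ∘ h ≈ π₁ ∘ k → h ≈ k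

  -- The witness is unique up to _≈_ by π-jointly-monic.
  record Summable {X Y : Obj} (f₀ f₁ : Y ⟶ X) : Set (ℓ ⊔ e) where
    constructor summable
    field
      ⟪⟫    : Y ⟶ S₀ X
      π₀-⟪⟫ : π₀ ∘ ⟪⟫ ≈ f₀
      π₁-⟪⟫ : π₁ ∘ ⟪⟫ ≈ f₁

    sum : Y ⟶ X
    sum = σ ∘ ⟪⟫

  open Summable public

  HasSum : ∀ {X Y} (f₀ f₁ s : Y ⟶ X) → Set (ℓ ⊔ e)
  HasSum f₀ f₁ s = Σ[ t ∈ Summable f₀ f₁ ] (sum t ≈ s)

  infix 4 _≤_
  _≤_ : ∀ {X Y} → Y ⟶ X → Y ⟶ X → Set (ℓ ⊔ e)
  _≤_ {X} {Y} f g = Σ[ h ∈ Y ⟶ X ] HasSum f h g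

  Monotone : ∀ {X Y} → (ℕ → X ⟶ Y) → Set (ℓ ⊔ e)
  Monotone f = Monotonic₁ _≤ℕ_ _≤_ f

  record IsLub {X Y} (f : ℕ → X ⟶ Y) (f∞ : X ⟶ Y) : Set (ℓ ⊔ e) where
    field
      upper : ∀ n → f n ≤ f∞
      least : ∀ {g} → (∀ n → f n ≤ g) → f∞ ≤ g

record SummabilityStructure {C : Category o ℓ e} {M : SymmetricMonoidal C}
                            (Z : ZeroMorphisms M) : Set (o ⊔ ℓ ⊔ e) where
  open Category C
  open ZeroMorphisms Z
  field
    preSummabilityStructure : PreSummabilityStructure C
  open PreSummabilityStructure preSummabilityStructure public
  field
    S-com  : ∀ {X} → HasSum (π₁ {X}) π₀ σ
    S-zero : ∀ {X} → HasSum (0⟶ {X} {X}) id id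
    S-wit  : ∀ {X Y} {f₀ f₁ : X ⟶ S₀ Y} → Summable (σ ∘ f₀) (σ ∘ f₁) → Summable f₀ f₁

module Summation {C : Category o ℓ e} {M : SymmetricMonoidal C} {Z : ZeroMorphisms M}
                 (S : SummabilityStructure Z) where
  open Category C
  open CategoryProperties C
  open ZeroMorphisms Z
  open SummabilityStructure S

  private
    variable
      X Y W : Obj
      f₀ f₁ f₂ g₀ g₁ : Y ⟶ X

  Summable-cong : f₀ ≈ g₀ → f₁ ≈ g₁ → Summable f₀ f₁ → Summable g₀ g₁
  Summable-cong p q (summable h h₀ h₁) = summable h (≈-trans h₀ p) (≈-trans h₁ q)

  sum-cong : f₀ ≈ g₀ → f₁ ≈ g₁ → (s : Summable f₀ f₁) (t : Summable g₀ g₁) → sum s ≈ sum t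
  sum-cong p q s t = ∘-congˡ (π-jointly-monic
    (≈-trans (π₀-⟪⟫ s) (≈-trans p (≈-sym (π₀-⟪⟫ t))))
    (≈-trans (π₁-⟪⟫ s) (≈-trans q (≈-sym (π₁-⟪⟫ t)))))

  Summable-∘ʳ : Summable f₀ f₁ → (k : W ⟶ Y) → Summable (f₀ ∘ k) (f₁ ∘ k)
  Summable-∘ʳ (summable h h₀ h₁) k = summable (h ∘ k) (pullˡ h₀) (pullˡ h₁)

  Summable-∘ˡ : (k : X ⟶ W) → Summable f₀ f₁ → Summable (k ∘ f₀) (k ∘ f₁)
  Summable-∘ˡ k (summable h h₀ h₁) = summable (S₁ k ∘ h)
    (≈-trans (glue π₀-natural) (∘-congˡ h₀))
    (≈-trans (glue π₁-natural) (∘-congˡ h₁))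

  Summable-sym : Summable f₀ f₁ → Summable f₁ f₀
  Summable-sym (summable h h₀ h₁) =
    Summable-cong h₁ h₀ (Summable-∘ʳ (proj₁ S-com) h)

  sum-sym : (s : Summable f₀ f₁) → sum (Summable-sym s) ≈ sum s
  sum-sym s = pullˡ (proj₂ S-com)

  ι₁-summable : ∀ {X} → Summable (0⟶ {X} {X}) id
  ι₁-summable = proj₁ S-zero

  ι₀-summable : ∀ {X} → Summable (id {X}) 0⟶
  ι₀-summable = Summable-sym ι₁-summable

  ι₀ ι₁ : ∀ {X} → X ⟶ S₀ X
  ι₀ = ⟪⟫ ι₀-summable
  ι₁ = ⟪⟫ ι₁-summable

  σ-ι₁ : ∀ {X} → σ ∘ ι₁ {X} ≈ id
  σ-ι₁ = proj₂ S-zero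

  σ-ι₀ : ∀ {X} → σ ∘ ι₀ {X} ≈ id
  σ-ι₀ = ≈-trans (sum-sym ι₁-summable) σ-ι₁

  -- If f₀ + (f₁ + f₂) is defined then so is f₀ + f₁.
  Summable-down : (s : Summable f₁ f₂) → Summable f₀ (sum s) → Summable f₀ f₁
  Summable-down {f₀ = f₀} s t = Summable-cong
    (≈-trans (pullˡ (π₀-⟪⟫ ι₀-summable)) identityˡ)
    (π₀-⟪⟫ s)
    (Summable-∘ˡ π₀ (S-wit (Summable-cong (≈-sym (≈-trans (pullˡ σ-ι₀) identityˡ)) ≈-refl t)))

  -- If (f₀ + f₁) + f₂ is defined then so is f₀ + (f₁ + f₂).
  Summable-assoc : (s : Summable f₀ f₁) → Summable (sum s) f₂ →
                   Σ[ t ∈ Summable f₁ f₂ ] Summable f₀ (sum t)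
  Summable-assoc {f₀ = f₀} {f₁ = f₁} {f₂ = f₂} s u = t , r
    where
    w : Summable (⟪⟫ s) (ι₁ ∘ f₂)
    w = S-wit (Summable-cong ≈-refl (≈-sym (≈-trans (pullˡ σ-ι₁) identityˡ)) u)

    t : Summable f₁ f₂
    t = Summable-cong (π₁-⟪⟫ s) (≈-trans (pullˡ (π₁-⟪⟫ ι₁-summable)) identityˡ)
          (Summable-∘ˡ π₁ w)

    a : Summable f₀ 0⟶
    a = Summable-cong (π₀-⟪⟫ s) (≈-trans (pullˡ (π₀-⟪⟫ ι₁-summable)) 0-∘)
          (Summable-∘ˡ π₀ w)

    a-sum : sum a ≈ f₀
    a-sum = ≈-trans
      (sum-cong (≈-sym identityˡ) (≈-sym 0-∘) a (Summable-∘ʳ ι₀-summable f₀))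
      (≈-trans (pullˡ σ-ι₀) identityˡ)

    rows : Summable (⟪⟫ a) (⟪⟫ t)
    rows = S-wit (summable (σ ∘ ⟪⟫ w)
      (≈-trans (glue (≈-sym σ-natural)) ≈-refl)
      (≈-trans (glue (≈-sym σ-natural)) ≈-refl))

    r : Summable f₀ (sum t)
    r = Summable-cong a-sum ≈-refl (Summable-∘ˡ σ rows)

  -- Abstract because only the equations π₀θ = π₀π₀ and π₁θ = π₀π₁ + π₁π₀ matter:
  -- they determine θ, the projections being jointly monic.
  abstract
    private
      θ-pair : ∀ {X} → Σ[ t ∈ Summable (π₀ ∘ π₁ {S₀ X}) (π₁ ∘ π₀) ] Summable (π₀ ∘ π₀) (sum t)
      θ-pair {X} = Summable-assoc column₀ (Summable-down column₁ columns)
        where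
        column₀ : Summable (π₀ ∘ π₀ {S₀ X}) (π₀ ∘ π₁)
        column₀ = summable (S₁ π₀) π₀-natural π₁-natural

        column₁ : Summable (π₁ ∘ π₀ {S₀ X}) (π₁ ∘ π₁)
        column₁ = summable (S₁ π₁) π₀-natural π₁-natural

        columns : Summable (sum column₀) (sum column₁)
        columns = summable σ (≈-sym σ-natural) (≈-sym σ-natural)

    θ₁-summable : ∀ {X} → Summable (π₀ ∘ π₁ {S₀ X}) (π₁ ∘ π₀)
    θ₁-summable = proj₁ θ-pair

    θ-summable : ∀ {X} → Summable (π₀ ∘ π₀ {S₀ X}) (sum θ₁-summable)
    θ-summable = proj₂ θ-pair

  θ : ∀ {X} → S₀ (S₀ X) ⟶ S₀ X
  θ = ⟪⟫ θ-summable

  -- πᵢπⱼc = πⱼπᵢ amounts to πⱼc = S πⱼ, by naturality of πᵢ.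
  c-summable : ∀ {X} → Summable (S₁ (π₀ {X})) (S₁ π₁)
  c-summable = S-wit (summable σ (≈-sym σ-natural) (≈-sym σ-natural))

  c : ∀ {X} → S₀ (S₀ X) ⟶ S₀ (S₀ X)
  c = ⟪⟫ c-summable

  -- The four equations πᵢπᵢl = πᵢ, πᵢπ₁₋ᵢl = 0 amount to π₀l = ι₀π₀ and π₁l = ι₁π₁.
  l-summable : ∀ {X} → Summable (ι₀ ∘ π₀ {X}) (ι₁ ∘ π₁)
  l-summable = S-wit (summable id
    (≈-trans identityʳ (≈-sym (≈-trans (pullˡ σ-ι₀) identityˡ)))
    (≈-trans identityʳ (≈-sym (≈-trans (pullˡ σ-ι₁) identityˡ))))

  l : ∀ {X} → S₀ X ⟶ S₀ (S₀ X)
  l = ⟪⟫ l-summable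

  0-least : (f : Y ⟶ X) → 0⟶ ≤ f
  0-least f = f , Summable-cong 0-∘ identityˡ (Summable-∘ʳ ι₁-summable f)
                , ≈-trans (pullˡ σ-ι₁) identityˡ

  ≤-respʳ : {f g h : Y ⟶ X} → g ≈ h → f ≤ g → f ≤ h
  ≤-respʳ p (k , s , q) = k , s , ≈-trans q p

  ≤-respˡ : {f g h : Y ⟶ X} → f ≈ g → f ≤ h → g ≤ h
  ≤-respˡ p (k , s , q) = k , Summable-cong p ≈-refl s , q

  ≤-∘ˡ : {f g : Y ⟶ X} (k : X ⟶ W) → f ≤ g → k ∘ f ≤ k ∘ g
  ≤-∘ˡ k (h , s , q) = k ∘ h , Summable-∘ˡ k s , ≈-trans (glue σ-natural) (∘-congˡ q)

  ≤-∘ʳ : {f g : Y ⟶ X} (k : W ⟶ Y) → f ≤ g → f ∘ k ≤ g ∘ k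
  ≤-∘ʳ k (h , s , q) = h ∘ k , Summable-∘ʳ s k , pullˡ q

record SummabilityCompatible (R : ResourceCategory o ℓ e)
  (S : SummabilityStructure (ResourceCategory.zeroMorphisms R)) : Set (o ⊔ ℓ ⊔ e) where
  open ResourceCategory R
  open Category category
  open SymmetricMonoidal monoidal
  open FiniteProducts products
  open SummabilityStructure S
  field
    S-⊗ : ∀ {X X′ Y Y′} {f₀ f₁ : X ⟶ X′} (s : Summable f₀ f₁) (g : Y ⟶ Y′) →
          HasSum (f₀ ⊗₁ g) (f₁ ⊗₁ g) (sum s ⊗₁ g)

    -- Finite products being given by ⊤ and _&_, this is the axiom for the empty
    -- family and for families of two objects.
    S-&⁰ : IsIso (!⊤ {S₀ ⊤})
    S-&² : ∀ {X₁ X₂} → IsIso (⟨ S₁ (p₁ {X₁} {X₂}) , S₁ p₂ ⟩)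

  κ : ∀ {X₁ X₂} → S₀ X₁ & S₀ X₂ ⟶ S₀ (X₁ & X₂)
  κ = IsIso.inv S-&²

module Strength {R : ResourceCategory o ℓ e}
  {S : SummabilityStructure (ResourceCategory.zeroMorphisms R)}
  (A : SummabilityCompatible R S) where
  open ResourceCategory R
  open Category category
  open CategoryProperties category
  open SymmetricMonoidal monoidal
  open SummabilityStructure S
  open Summation S
  open SummabilityCompatible A

  π-summable : ∀ {X} → Summable (π₀ {X}) π₁
  π-summable = summable id identityʳ identityʳ

  φ¹-summable : ∀ {X₁ X₂} → Summable (π₀ {X₁} ⊗₁ id {X₂}) (π₁ ⊗₁ id)
  φ¹-summable = proj₁ (S-⊗ π-summable id)

  φ¹ : ∀ {X₁ X₂} → S₀ X₁ ⊗ X₂ ⟶ S₀ (X₁ ⊗ X₂)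
  φ¹ = ⟪⟫ φ¹-summable

  private
    φ² : ∀ {X₁ X₂} → X₁ ⊗ S₀ X₂ ⟶ S₀ (X₁ ⊗ X₂)
    φ² = S₁ γ ∘ φ¹ ∘ γ

    conj-γ : ∀ {X X′ Y} {f : X ⟶ X′} → γ ∘ (f ⊗₁ id {Y}) ∘ γ ≈ id ⊗₁ f
    conj-γ = ≈-trans (glue γ-natural) (≈-trans (∘-congˡ γ-involutive) identityʳ)

    π₀-φ² : ∀ {X₁ X₂} → π₀ ∘ φ² {X₁} {X₂} ≈ id ⊗₁ π₀
    π₀-φ² = ≈-trans (glue π₀-natural) (≈-trans (∘-congˡ (pullˡ (π₀-⟪⟫ φ¹-summable))) conj-γ)

    π₁-φ² : ∀ {X₁ X₂} → π₁ ∘ φ² {X₁} {X₂} ≈ id ⊗₁ π₁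
    π₁-φ² = ≈-trans (glue π₁-natural) (≈-trans (∘-congˡ (pullˡ (π₁-⟪⟫ φ¹-summable))) conj-γ)

    ⊗-split : ∀ {X X′ Y Y′} {f : X ⟶ X′} {g : Y ⟶ Y′} → (id ⊗₁ g) ∘ (f ⊗₁ id) ≈ f ⊗₁ g
    ⊗-split = ≈-trans (≈-sym ⊗-∘) (⊗-cong identityˡ identityʳ)

    L′ : ∀ {X₁ X₂} → S₀ X₁ ⊗ S₀ X₂ ⟶ S₀ (S₀ (X₁ ⊗ X₂))
    L′ = S₁ φ² ∘ φ¹

    π-L′ : ∀ {X₁ X₂} {f : ∀ {X} → S₀ X ⟶ X} {g : ∀ {X} → S₀ X ⟶ X} →
           (∀ {X Y} {k : X ⟶ Y} → g ∘ S₁ k ≈ k ∘ g) →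
           (∀ {X₁ X₂} → f ∘ φ² {X₁} {X₂} ≈ id ⊗₁ f) →
           (∀ {X₁ X₂} → g ∘ φ¹ {X₁} {X₂} ≈ g ⊗₁ id) →
           (f ∘ g) ∘ L′ {X₁} {X₂} ≈ g ⊗₁ f
    π-L′ {f = f} {g} nat qf qg = begin
      (f ∘ g) ∘ S₁ φ² ∘ φ¹     ≈⟨ assoc ⟩
      f ∘ g ∘ S₁ φ² ∘ φ¹       ≈⟨ ∘-congˡ (glue nat) ⟩
      f ∘ φ² ∘ g ∘ φ¹          ≈⟨ pullˡ qf ⟩
      (id ⊗₁ f) ∘ g ∘ φ¹       ≈⟨ ∘-congˡ qg ⟩
      (id ⊗₁ f) ∘ (g ⊗₁ id)    ≈⟨ ⊗-split ⟩
      g ⊗₁ f                   ∎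

  abstract
    L₁-summable : ∀ {X₁ X₂} → Summable (π₁ {X₁} ⊗₁ π₀ {X₂}) (π₀ ⊗₁ π₁)
    L₁-summable = Summable-cong
      (π-L′ π₁-natural π₀-φ² (π₁-⟪⟫ φ¹-summable))
      (π-L′ π₀-natural π₁-φ² (π₀-⟪⟫ φ¹-summable))
      (Summable-∘ʳ θ₁-summable L′)

    L-summable : ∀ {X₁ X₂} → Summable (π₀ {X₁} ⊗₁ π₀ {X₂}) (sum L₁-summable)
    L-summable = Summable-cong
      (π-L′ π₀-natural π₀-φ² (π₀-⟪⟫ φ¹-summable))
      assoc
      (Summable-∘ʳ θ-summable L′)

  L : ∀ {X₁ X₂} → S₀ X₁ ⊗ S₀ X₂ ⟶ S₀ (X₁ ⊗ X₂)
  L = ⟪⟫ L-summable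

  φ⊸ : (cl : Closed monoidal) → let open Closed cl in
       ∀ {X Y} → S₀ (X ⊸ Y) ⟶ X ⊸ S₀ Y
  φ⊸ cl = let open Closed cl in cur (S₁ ev ∘ φ¹)

record DifferentialStructure {R : ResourceCategory o ℓ e}
  {S : SummabilityStructure (ResourceCategory.zeroMorphisms R)}
  (A : SummabilityCompatible R S) : Set (o ⊔ ℓ ⊔ e) where
  open ResourceCategory R
  open Category category
  open SymmetricMonoidal monoidal
  open ZeroMorphisms zeroMorphisms
  open FiniteProducts products
  open ResourceModality resourceModality
  open SummabilityStructure S
  open Summation S
  open SummabilityCompatible A
  open Strength A
  field
    ∂ : ∀ {X} → !₀ (S₀ X) ⟶ S₀ (!₀ X)
    ∂-natural : ∀ {X Y} {f : X ⟶ Y} → ∂ {Y} ∘ !₁ (S₁ f) ≈ S₁ (!₁ f) ∘ ∂ {X}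
    ∂-chain-der : ∀ {X} → S₁ (der {X}) ∘ ∂ {X} ≈ der {S₀ X}
    ∂-chain-dig : ∀ {X} → S₁ (dig {X}) ∘ ∂ {X} ≈ ∂ { !₀ X} ∘ !₁ (∂ {X}) ∘ dig {S₀ X}
    ∂-local     : ∀ {X} → π₀ { !₀ X} ∘ ∂ {X} ≈ !₁ (π₀ {X})
    ∂-add-ι₀    : ∀ {X} → ∂ {X} ∘ !₁ (ι₀ {X}) ≈ ι₀ { !₀ X}
    ∂-add-θ     : ∀ {X} → ∂ {X} ∘ !₁ (θ {X}) ≈ θ { !₀ X} ∘ S₁ (∂ {X}) ∘ ∂ {S₀ X}
    ∂-&⁰        : ∂ {⊤} ∘ !₁ (0⟶ {⊤}) ∘ m⁰ ≈ S₁ m⁰ ∘ ι₀ {𝟙}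
    ∂-&²        : ∀ {X₁ X₂} →
                  ∂ {X₁ & X₂} ∘ !₁ (κ {X₁} {X₂}) ∘ m² {S₀ X₁} {S₀ X₂}
                  ≈ S₁ (m² {X₁} {X₂}) ∘ L { !₀ X₁} { !₀ X₂} ∘ (∂ {X₁} ⊗₁ ∂ {X₂})
    ∂-Schwarz   : ∀ {X} → c { !₀ X} ∘ S₁ (∂ {X}) ∘ ∂ {S₀ X} ≈ S₁ (∂ {X}) ∘ ∂ {S₀ X} ∘ !₁ (c {X})
    ∂-lift      : ∀ {X} → l { !₀ X} ∘ ∂ {X} ≈ S₁ (∂ {X}) ∘ ∂ {S₀ X} ∘ !₁ (l {X})

record CoherentDifferentialResourceCategory (o ℓ e : Level) : Set (lsuc (o ⊔ ℓ ⊔ e)) where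
  field
    resourceCategory : ResourceCategory o ℓ e
  open ResourceCategory resourceCategory public
  field
    summability  : SummabilityStructure zeroMorphisms
    compatible   : SummabilityCompatible resourceCategory summability
    -- (S-⊸) is required only if the category is closed, hence the quantification.
    S-⊸          : (cl : Closed monoidal) → let open Category category; open Closed cl in
                   ∀ {X Y} → IsIso (Strength.φ⊸ compatible cl {X} {Y})
    differential : DifferentialStructure compatible

module Kleisli (𝓛 : CoherentDifferentialResourceCategory o ℓ e) where
  open CoherentDifferentialResourceCategory 𝓛
  open Category category
  open FiniteProducts products
  open ResourceModality resourceModality
  open SummabilityStructure summability
  open Summation summability
  open SummabilityCompatible compatible
  open DifferentialStructure differential

  -- Products in the Kleisli category are those of the base category; in
  -- particular the Kleisli pairing of f and g is ⟨ f , g ⟩.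

  infix  4 _⟶!_
  infixr 9 _∘!_

  _⟶!_ : Obj → Obj → Set ℓ
  X ⟶! Y = !₀ X ⟶ Y

  _∘!_ : ∀ {X Y Z} → Y ⟶! Z → X ⟶! Y → X ⟶! Z
  g ∘! f = g ∘ !₁ f ∘ dig

  Der : ∀ {X Y} → X ⟶ Y → X ⟶! Y
  Der f = f ∘ der

  D₀ : Obj → Obj
  D₀ = S₀

  D : ∀ {X Y} → X ⟶! Y → D₀ X ⟶! D₀ Y
  D f = S₁ f ∘ ∂

  ψ² : ∀ {X₁ X₂} → X₁ & D₀ X₂ ⟶! D₀ (X₁ & X₂)
  ψ² = Der (κ ∘ (ι₀ &₁ id))

  D₂ : ∀ {X₁ X₂ Y} → X₁ & X₂ ⟶! Y → X₁ & D₀ X₂ ⟶! D₀ Y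
  D₂ f = D f ∘! ψ²

  θ! : ∀ {X} → D₀ (D₀ X) ⟶! D₀ X
  θ! = Der θ

record Scott (𝓛 : CoherentDifferentialResourceCategory o ℓ e) : Set (o ⊔ ℓ ⊔ e) where
  open CoherentDifferentialResourceCategory 𝓛
  open Category category
  open SymmetricMonoidal monoidal
  open ResourceModality resourceModality
  open SummabilityStructure summability

  field
    ≤-isPartialOrder : ∀ {X Y} → IsPartialOrder (_≈_ {X} {Y}) _≤_
    lub    : ∀ {X Y} {f : ℕ → X ⟶ Y} → Monotone f → Σ[ f∞ ∈ X ⟶ Y ] IsLub f f∞
    ∘-lub  : ∀ {X Y Z} {g : ℕ → Y ⟶ Z} {f : ℕ → X ⟶ Y} {g∞ f∞} →
             Monotone g → Monotone f → IsLub g g∞ → IsLub f f∞ →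
             IsLub (λ n → g n ∘ f n) (g∞ ∘ f∞)
    ⊗-lub  : ∀ {X X′ Y Y′} {f : ℕ → X ⟶ X′} {g : ℕ → Y ⟶ Y′} {f∞ g∞} →
             Monotone f → Monotone g → IsLub f f∞ → IsLub g g∞ →
             IsLub (λ n → f n ⊗₁ g n) (f∞ ⊗₁ g∞)
    !-mono : ∀ {X Y} {f g : X ⟶ Y} → f ≤ g → !₁ f ≤ !₁ g
    !-lub  : ∀ {X Y} {f : ℕ → X ⟶ Y} {f∞} →
             Monotone f → IsLub f f∞ → IsLub (λ n → !₁ (f n)) (!₁ f∞)

module CartesianClosed (𝓛 : CoherentDifferentialResourceCategory o ℓ e)
  (cl : Closed (CoherentDifferentialResourceCategory.monoidal 𝓛)) where
  open CoherentDifferentialResourceCategory 𝓛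
  open Category category
  open SymmetricMonoidal monoidal
  open FiniteProducts products
  open ZeroMorphisms zeroMorphisms
  open ResourceModality resourceModality
  open SummabilityStructure summability
  open Strength compatible
  open Kleisli 𝓛
  open Closed cl

  infixr 8 _⇒_ _⇒₁_

  _⇒_ : Obj → Obj → Obj
  X ⇒ Y = !₀ X ⊸ Y

  Ev : ∀ {X Y} → (X ⇒ Y) & X ⟶! Y
  Ev = ev ∘ (der ⊗₁ id) ∘ IsIso.inv m²-iso

  Cur : ∀ {X Y Z} → Z & X ⟶! Y → Z ⟶! X ⇒ Y
  Cur f = cur (f ∘ m²)

  _⇒₁_ : ∀ (X : Obj) {Y Z} → Y ⟶! Z → X ⇒ Y ⟶! X ⇒ Z
  X ⇒₁ g = Cur (g ∘! Ev)

  𝒟 : ∀ {X Y} → X ⇒ Y ⟶! D₀ X ⇒ D₀ Y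
  𝒟 = Cur (D Ev ∘! ψ²)

  ψ : ∀ {Y U} → D₀ (Y ⇒ U) ⟶! Y ⇒ D₀ U
  ψ = Der (φ⊸ cl)

  step : ∀ {W Y} → W ⟶! Y ⇒ Y → W ⟶! Y → W ⟶! Y
  step f g = Ev ∘! ⟨ f , g ⟩

  record IsLeastFixpoint {W Y} (f : W ⟶! Y ⇒ Y) (g : W ⟶! Y) : Set (ℓ ⊔ e) where
    field
      fixpoint : step f g ≈ g
      least    : ∀ {h} → step f h ≈ h → g ≤ h

  fixₙ : ∀ {W Y} → W ⟶! Y ⇒ Y → ℕ → W ⟶! Y
  fixₙ f zero    = 0⟶
  fixₙ f (suc n) = step f (fixₙ f n)

module Fixpoint (𝓛 : CoherentDifferentialResourceCategory o ℓ e)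
  (cl : Closed (CoherentDifferentialResourceCategory.monoidal 𝓛))
  (scott : Scott 𝓛) where
  open CoherentDifferentialResourceCategory 𝓛
  open Category category
  open CategoryProperties category
  open ZeroMorphisms zeroMorphisms
  open FiniteProducts products
  open ResourceModality resourceModality
  open SummabilityStructure summability
  open Summation summability
  open SummabilityCompatible compatible
  open Kleisli 𝓛
  open CartesianClosed 𝓛 cl
  open Scott scott

  private
    module ≤ {X Y} = IsPartialOrder (≤-isPartialOrder {X} {Y})

  module _ {X Y : Obj} where

    chain⇒Monotone : {f : ℕ → X ⟶ Y} → (∀ n → f n ≤ f (suc n)) → Monotone f
    chain⇒Monotone {f} p {zero}  {zero}  z≤n = ≤.refl
    chain⇒Monotone {f} p {zero}  {suc n} z≤n =
      ≤.trans (chain⇒Monotone {f} p {zero} {n} z≤n) (p n)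
    chain⇒Monotone {f} p {suc m} {suc n} (s≤s q) =
      chain⇒Monotone {λ k → f (suc k)} (λ k → p (suc k)) {m} {n} q

    constant-Monotone : {f : X ⟶ Y} → Monotone (λ _ → f)
    constant-Monotone _ = ≤.refl

    constant-lub : {f : X ⟶ Y} → IsLub (λ _ → f) f
    constant-lub = record { upper = λ _ → ≤.refl ; least = λ p → p 0 }

    lub-unique : {f g : ℕ → X ⟶ Y} {f∞ g∞ : X ⟶ Y} → (∀ n → f n ≈ g n) →
                 IsLub f f∞ → IsLub g g∞ → f∞ ≈ g∞
    lub-unique p u v = ≤.antisym
      (IsLub.least u (λ n → ≤-respˡ (≈-sym (p n)) (IsLub.upper v n)))
      (IsLub.least v (λ n → ≤-respˡ (p n) (IsLub.upper u n)))

    lub-resp : {f : ℕ → X ⟶ Y} {f∞ g∞ : X ⟶ Y} → f∞ ≈ g∞ → IsLub f f∞ → IsLub f g∞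
    lub-resp p u = record
      { upper = λ n → ≤-respʳ p (IsLub.upper u n)
      ; least = λ q → ≤-respˡ p (IsLub.least u q) }

  ⟨⟩-mono : ∀ {X Y Z} (f : Z ⟶ X) {g g′ : Z ⟶ Y} → g ≤ g′ → ⟨ f , g ⟩ ≤ ⟨ f , g′ ⟩
  ⟨⟩-mono f {g} {g′} (h , s , q) = ⟨ 0⟶ , h ⟩ , summable w w₀ w₁ , w-sum
    where
    w = κ ∘ ⟨ ι₀ ∘ f , ⟪⟫ s ⟩

    Sp₁-w : S₁ p₁ ∘ w ≈ ι₀ ∘ f
    Sp₁-w = begin
      S₁ p₁ ∘ w                                ≈⟨ ∘-congʳ p₁-⟨⟩ ⟨
      (p₁ ∘ ⟨ S₁ p₁ , S₁ p₂ ⟩) ∘ w             ≈⟨ assoc ⟩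
      p₁ ∘ ⟨ S₁ p₁ , S₁ p₂ ⟩ ∘ w               ≈⟨ ∘-congˡ (pullˡ (IsIso.invʳ S-&²)) ⟩
      p₁ ∘ id ∘ ⟨ ι₀ ∘ f , ⟪⟫ s ⟩              ≈⟨ ∘-congˡ identityˡ ⟩
      p₁ ∘ ⟨ ι₀ ∘ f , ⟪⟫ s ⟩                   ≈⟨ p₁-⟨⟩ ⟩
      ι₀ ∘ f                                   ∎

    Sp₂-w : S₁ p₂ ∘ w ≈ ⟪⟫ s
    Sp₂-w = begin
      S₁ p₂ ∘ w                                ≈⟨ ∘-congʳ p₂-⟨⟩ ⟨
      (p₂ ∘ ⟨ S₁ p₁ , S₁ p₂ ⟩) ∘ w             ≈⟨ assoc ⟩
      p₂ ∘ ⟨ S₁ p₁ , S₁ p₂ ⟩ ∘ w               ≈⟨ ∘-congˡ (pullˡ (IsIso.invʳ S-&²)) ⟩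
      p₂ ∘ id ∘ ⟨ ι₀ ∘ f , ⟪⟫ s ⟩              ≈⟨ ∘-congˡ identityˡ ⟩
      p₂ ∘ ⟨ ι₀ ∘ f , ⟪⟫ s ⟩                   ≈⟨ p₂-⟨⟩ ⟩
      ⟪⟫ s                                     ∎

    w₀ : π₀ ∘ w ≈ ⟨ f , g ⟩
    w₀ = ⟨⟩-unique
      (≈-trans (glue (≈-sym π₀-natural)) (≈-trans (∘-congˡ Sp₁-w)
        (≈-trans (pullˡ (π₀-⟪⟫ ι₀-summable)) identityˡ)))
      (≈-trans (glue (≈-sym π₀-natural)) (≈-trans (∘-congˡ Sp₂-w) (π₀-⟪⟫ s)))

    w₁ : π₁ ∘ w ≈ ⟨ 0⟶ , h ⟩
    w₁ = ⟨⟩-unique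
      (≈-trans (glue (≈-sym π₁-natural)) (≈-trans (∘-congˡ Sp₁-w)
        (≈-trans (pullˡ (π₁-⟪⟫ ι₀-summable)) 0-∘)))
      (≈-trans (glue (≈-sym π₁-natural)) (≈-trans (∘-congˡ Sp₂-w) (π₁-⟪⟫ s)))

    w-sum : σ ∘ w ≈ ⟨ f , g′ ⟩
    w-sum = ⟨⟩-unique
      (≈-trans (glue (≈-sym σ-natural)) (≈-trans (∘-congˡ Sp₁-w)
        (≈-trans (pullˡ σ-ι₀) identityˡ)))
      (≈-trans (glue (≈-sym σ-natural)) (≈-trans (∘-congˡ Sp₂-w) q))

  ⟨⟩-lub : ∀ {X Y Z} (f : Z ⟶ X) {g : ℕ → Z ⟶ Y} {g∞ : Z ⟶ Y} →
           Monotone g → IsLub g g∞ → IsLub (λ n → ⟨ f , g n ⟩) ⟨ f , g∞ ⟩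
  ⟨⟩-lub f {g} {g∞} mono u = lub-resp (⟨⟩-unique
      (lub-unique (λ _ → p₁-⟨⟩) (∘-lub constant-Monotone pairs constant-lub h-lub) constant-lub)
      (lub-unique (λ _ → p₂-⟨⟩) (∘-lub constant-Monotone pairs constant-lub h-lub) u))
    h-lub
    where
    pairs : Monotone (λ n → ⟨ f , g n ⟩)
    pairs q = ⟨⟩-mono f (mono q)

    h-lub = proj₂ (lub pairs)

  step-mono : ∀ {W Y} (f : W ⟶! Y ⇒ Y) {g g′ : W ⟶! Y} → g ≤ g′ → step f g ≤ step f g′
  step-mono f p = ≤-∘ˡ Ev (≤-∘ʳ dig (!-mono (⟨⟩-mono f p)))

  step-lub : ∀ {W Y} (f : W ⟶! Y ⇒ Y) {g : ℕ → W ⟶! Y} {g∞ : W ⟶! Y} →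
             Monotone g → IsLub g g∞ → IsLub (λ n → step f (g n)) (step f g∞)
  step-lub f mono u =
    ∘-lub constant-Monotone (λ q → ≤-∘ʳ dig (!-mono (⟨⟩-mono f (mono q)))) constant-lub
      (∘-lub (λ q → !-mono (⟨⟩-mono f (mono q))) constant-Monotone
        (!-lub (λ q → ⟨⟩-mono f (mono q)) (⟨⟩-lub f mono u)) constant-lub)

  fixₙ-Monotone : ∀ {W Y} (f : W ⟶! Y ⇒ Y) → Monotone (fixₙ f)
  fixₙ-Monotone f = chain⇒Monotone chain
    where
    chain : ∀ n → fixₙ f n ≤ fixₙ f (suc n)
    chain zero    = 0-least _
    chain (suc n) = step-mono f (chain n)

  -- The least fixpoint of step f (fix-isLeastFixpoint), obtained as the lub of fixₙ f.
  fix : ∀ {W Y} → W ⟶! Y ⇒ Y → W ⟶! Y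
  fix f = proj₁ (lub (fixₙ-Monotone f))

  fix-isLub : ∀ {W Y} (f : W ⟶! Y ⇒ Y) → IsLub (fixₙ f) (fix f)
  fix-isLub f = proj₂ (lub (fixₙ-Monotone f))

  fix-isLeastFixpoint : ∀ {W Y} (f : W ⟶! Y ⇒ Y) → IsLeastFixpoint f (fix f)
  fix-isLeastFixpoint f = record
    { fixpoint = ≤.antisym
        (IsLub.least shifted (λ n → IsLub.upper (fix-isLub f) (suc n)))
        (IsLub.least (fix-isLub f) λ n →
          ≤.trans (fixₙ-Monotone f (n≤1+n n)) (IsLub.upper shifted n))
    ; least = λ {h} p → IsLub.least (fix-isLub f) (below h p)
    }
    where
    shifted : IsLub (λ n → fixₙ f (suc n)) (step f (fix f))
    shifted = step-lub f (fixₙ-Monotone f) (fix-isLub f)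

    below : ∀ h → step f h ≈ h → ∀ n → fixₙ f n ≤ h
    below h p zero    = 0-least h
    below h p (suc n) = ≤-respʳ p (step-mono f (below h p n))

{-# OPTIONS --safe #-}

-- By ∂-&², Ev ∘! (ψ & id) is the partial derivative D Ev ∘! ψ¹ of Ev in its
-- function argument, where ψ¹ is the mirror image κ ∘ (id &₁ ι₀) of ψ².
-- Additivity of ∂ makes θ natural for D, which recombines the two partial derivatives:
--   θ ∘! D (D Ev ∘! ψ¹) ∘! ψ² ≈ D Ev ∘! (θ ∘ S ψ¹ ∘ ψ²) ≈ D Ev ∘! κ.
-- With functoriality of D this says that D₂ intertwines the two step operators,
-- so D₂ (fixₙ f) is the n-th approximant of the right-hand side.  D₂ preserves lubs
-- because S does: the lub of the S₁ fₙ is determined by its composites with π₀ and π₁.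

module Submission where

open import Defs
open import Level using (Level)
open import Data.Nat using (ℕ; zero; suc)
open import Data.Product using (_,_; proj₁; proj₂)

private
  variable
    o ℓ e : Level

-- Pairings in finite products.

module ProductProperties {C : Category o ℓ e} (P : FiniteProducts C) where
  open Category C
  open CategoryProperties C
  open FiniteProducts P

  private
    variable
      V W X X′ Y Y′ : Obj

  ⟨⟩-cong : {f f′ : W ⟶ X} {g g′ : W ⟶ Y} → f ≈ f′ → g ≈ g′ → ⟨ f , g ⟩ ≈ ⟨ f′ , g′ ⟩
  ⟨⟩-cong p q = ⟨⟩-unique (≈-trans p₁-⟨⟩ p) (≈-trans p₂-⟨⟩ q)

  ⟨⟩-∘ : {f : W ⟶ X} {g : W ⟶ Y} {h : V ⟶ W} → ⟨ f , g ⟩ ∘ h ≈ ⟨ f ∘ h , g ∘ h ⟩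
  ⟨⟩-∘ = ⟨⟩-unique (pullˡ p₁-⟨⟩) (pullˡ p₂-⟨⟩)

  &₁-⟨⟩ : {u : X ⟶ X′} {v : Y ⟶ Y′} {f : W ⟶ X} {g : W ⟶ Y} →
          (u &₁ v) ∘ ⟨ f , g ⟩ ≈ ⟨ u ∘ f , v ∘ g ⟩
  &₁-⟨⟩ = ≈-trans ⟨⟩-∘
    (⟨⟩-cong (≈-trans assoc (∘-congˡ p₁-⟨⟩)) (≈-trans assoc (∘-congˡ p₂-⟨⟩)))

-- The monad structure of `S₁`, and its monotonicity.

module SummationProperties {C : Category o ℓ e} {M : SymmetricMonoidal C}
  {Z : ZeroMorphisms M} (S : SummabilityStructure Z) where
  open Category C
  open CategoryProperties C
  open ZeroMorphisms Z
  open SummabilityStructure S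
  open Summation S

  private
    variable
      X Y : Obj
      f f₀ f₁ g : Y ⟶ X

  -- By joint monicity the witness is forced to be `ι₁ ∘ f₁`, and `σ ∘ ι₁ ≈ id`.
  sum-0ˡ : f₀ ≈ 0⟶ → (s : Summable f₀ f₁) → sum s ≈ f₁
  sum-0ˡ {f₁ = f₁} p s = ≈-trans
    (sum-cong (≈-trans p (≈-sym 0-∘)) (≈-sym identityˡ) s (Summable-∘ʳ ι₁-summable f₁))
    (≈-trans (pullˡ σ-ι₁) identityˡ)

  sum-0ʳ : f₁ ≈ 0⟶ → (s : Summable f₀ f₁) → sum s ≈ f₀
  sum-0ʳ p s = ≈-trans (≈-sym (sum-sym s)) (sum-0ˡ p (Summable-sym s))

  π₀-ι₀ : π₀ ∘ ι₀ {X} ≈ id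
  π₀-ι₀ = π₀-⟪⟫ ι₀-summable

  π₁-ι₀ : π₁ ∘ ι₀ {X} ≈ 0⟶
  π₁-ι₀ = π₁-⟪⟫ ι₀-summable

  ι₀-natural : S₁ f ∘ ι₀ ≈ ι₀ ∘ f
  ι₀-natural = π-jointly-monic
    (≈-trans (glue π₀-natural) (≈-trans (∘-congˡ π₀-ι₀)
      (≈-trans identityʳ (≈-sym (≈-trans (pullˡ π₀-ι₀) identityˡ)))))
    (≈-trans (glue π₁-natural) (≈-trans (∘-congˡ π₁-ι₀)
      (≈-trans ∘-0 (≈-sym (≈-trans (pullˡ π₁-ι₀) 0-∘)))))

  S-0 : S₁ (0⟶ {X} {Y}) ≈ 0⟶
  S-0 = π-jointly-monic
    (≈-trans π₀-natural (≈-trans 0-∘ (≈-sym ∘-0)))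
    (≈-trans π₁-natural (≈-trans 0-∘ (≈-sym ∘-0)))

  π₀-θ : π₀ ∘ θ {X} ≈ π₀ ∘ π₀
  π₀-θ = π₀-⟪⟫ θ-summable

  π₁-θ : π₁ ∘ θ {X} ≈ sum θ₁-summable
  π₁-θ = π₁-⟪⟫ θ-summable

  -- On `π₁` both sides are sums whose summands match one by one by naturality of the projections;
  -- `sum-cong` then makes the choice of witnesses irrelevant.
  θ-natural : {f : Y ⟶ X} → θ ∘ S₁ (S₁ f) ≈ S₁ f ∘ θ
  θ-natural {f = f} = π-jointly-monic
    (begin
      π₀ ∘ θ ∘ S₁ (S₁ f)           ≈⟨ pullˡ π₀-θ ⟩
      (π₀ ∘ π₀) ∘ S₁ (S₁ f)        ≈⟨ assoc ⟩
      π₀ ∘ π₀ ∘ S₁ (S₁ f)          ≈⟨ ∘-congˡ π₀-natural ⟩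
      π₀ ∘ S₁ f ∘ π₀               ≈⟨ glue π₀-natural ⟩
      f ∘ π₀ ∘ π₀                  ≈⟨ ∘-congˡ π₀-θ ⟨
      f ∘ π₀ ∘ θ                   ≈⟨ glue π₀-natural ⟨
      π₀ ∘ S₁ f ∘ θ                ∎)
    (begin
      π₁ ∘ θ ∘ S₁ (S₁ f)           ≈⟨ pullˡ π₁-θ ⟩
      sum θ₁-summable ∘ S₁ (S₁ f)  ≈⟨ assoc ⟩
      sum (Summable-∘ʳ θ₁-summable (S₁ (S₁ f)))
        ≈⟨ sum-cong
             (≈-trans assoc (≈-trans (∘-congˡ π₁-natural) (glue π₀-natural)))
             (≈-trans assoc (≈-trans (∘-congˡ π₀-natural) (glue π₁-natural)))
             (Summable-∘ʳ θ₁-summable (S₁ (S₁ f))) (Summable-∘ˡ f θ₁-summable) ⟩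
      sum (Summable-∘ˡ f θ₁-summable)
                                   ≈⟨ glue σ-natural ⟩
      f ∘ sum θ₁-summable          ≈⟨ ∘-congˡ π₁-θ ⟨
      f ∘ π₁ ∘ θ                   ≈⟨ glue π₁-natural ⟨
      π₁ ∘ S₁ f ∘ θ                ∎)

  -- First unit law of the monad. In `π₁ ∘ θ` the summand `π₀ ∘ π₁` is killed by `π₁ ∘ ι₀ ≈ 0⟶`,
  -- which leaves `π₁`.
  θ-ι₀ : θ ∘ ι₀ {S₀ X} ≈ id
  θ-ι₀ = π-jointly-monic
    (≈-trans (pullˡ π₀-θ) (≈-trans assoc (∘-congˡ π₀-ι₀)))
    (≈-trans (pullˡ π₁-θ) (≈-trans assoc (≈-trans
      (sum-0ˡ (≈-trans assoc (≈-trans (∘-congˡ π₁-ι₀) ∘-0)) (Summable-∘ʳ θ₁-summable ι₀))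
      (≈-trans assoc (∘-congˡ π₀-ι₀)))))

  -- Second unit law. Here the other summand vanishes: naturality gives
  -- `π₁ ∘ π₀ ∘ S₁ ι₀ ≈ π₁ ∘ ι₀ ∘ π₀`, which is zero.
  θ-Sι₀ : θ ∘ S₁ (ι₀ {X}) ≈ id
  θ-Sι₀ = π-jointly-monic
    (≈-trans (pullˡ π₀-θ) (≈-trans assoc (≈-trans (∘-congˡ π₀-natural) absorb)))
    (≈-trans (pullˡ π₁-θ) (≈-trans assoc (≈-trans
      (sum-0ʳ (≈-trans assoc (≈-trans (∘-congˡ π₀-natural) (≈-trans (pullˡ π₁-ι₀) 0-∘)))
        (Summable-∘ʳ θ₁-summable (S₁ ι₀)))
      (≈-trans assoc (≈-trans (∘-congˡ π₁-natural) absorb)))))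
    where
    absorb : {k : Y ⟶ X} → π₀ ∘ ι₀ ∘ k ≈ k ∘ id
    absorb = ≈-trans (pullˡ π₀-ι₀) (≈-trans identityˡ (≈-sym identityʳ))

  -- The flip exchanges the two layers of `S₀`, hence outer and inner sum. After each projection
  -- both sides become `σ ∘ πᵢ`, since `S₁ πᵢ ∘ c ≈ πᵢ`.
  σ-c : σ ∘ c {X} ≈ S₁ σ
  σ-c = π-jointly-monic
    (≈-trans (glue (≈-sym σ-natural)) (≈-trans (∘-congˡ Sπ₀-c) (≈-sym π₀-natural)))
    (≈-trans (glue (≈-sym σ-natural)) (≈-trans (∘-congˡ Sπ₁-c) (≈-sym π₁-natural)))
    where
    π₀-c : π₀ ∘ c {X} ≈ S₁ π₀
    π₀-c = π₀-⟪⟫ c-summable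

    π₁-c : π₁ ∘ c {X} ≈ S₁ π₁
    π₁-c = π₁-⟪⟫ c-summable

    Sπ₀-c : S₁ π₀ ∘ c {X} ≈ π₀
    Sπ₀-c = π-jointly-monic
      (≈-trans (glue π₀-natural) (≈-trans (∘-congˡ π₀-c) π₀-natural))
      (≈-trans (glue π₁-natural) (≈-trans (∘-congˡ π₁-c) π₀-natural))

    Sπ₁-c : S₁ π₁ ∘ c {X} ≈ π₁
    Sπ₁-c = π-jointly-monic
      (≈-trans (glue π₀-natural) (≈-trans (∘-congˡ π₀-c) π₁-natural))
      (≈-trans (glue π₁-natural) (≈-trans (∘-congˡ π₁-c) π₁-natural))

  -- Applying `S₁` to a witness puts the new layer of `S₀` on the outside; the flip `c` brings the
  -- summation layer back out, and `σ-c` computes the sum.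
  S-mono : f ≤ g → S₁ f ≤ S₁ g
  S-mono (h , s , q) = S₁ h
    , summable (c ∘ S₁ (⟪⟫ s))
        (≈-trans (pullˡ (π₀-⟪⟫ c-summable)) (≈-trans (≈-sym S-∘) (S-cong (π₀-⟪⟫ s))))
        (≈-trans (pullˡ (π₁-⟪⟫ c-summable)) (≈-trans (≈-sym S-∘) (S-cong (π₁-⟪⟫ s))))
    , ≈-trans (pullˡ σ-c) (≈-trans (≈-sym S-∘) (S-cong q))

-- The distributivity `κ` over products and the double strength `L`.

module CompatibilityProperties {R : ResourceCategory o ℓ e}
  {S : SummabilityStructure (ResourceCategory.zeroMorphisms R)}
  (A : SummabilityCompatible R S) where
  open ResourceCategory R
  open Category category
  open CategoryProperties category
  open SymmetricMonoidal monoidal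
  open ZeroMorphisms zeroMorphisms
  open FiniteProducts products
  open ProductProperties products
  open SummabilityStructure S
  open Summation S
  open SummationProperties S
  open SummabilityCompatible A
  open Strength A

  private
    variable
      W X X′ Y Y′ : Obj

  Sp₁-κ : S₁ p₁ ∘ κ {X} {Y} ≈ p₁
  Sp₁-κ = begin
    S₁ p₁ ∘ κ                       ≈⟨ ∘-congʳ p₁-⟨⟩ ⟨
    (p₁ ∘ ⟨ S₁ p₁ , S₁ p₂ ⟩) ∘ κ    ≈⟨ assoc ⟩
    p₁ ∘ ⟨ S₁ p₁ , S₁ p₂ ⟩ ∘ κ      ≈⟨ ∘-congˡ (IsIso.invʳ S-&²) ⟩
    p₁ ∘ id                         ≈⟨ identityʳ ⟩
    p₁                              ∎

  Sp₂-κ : S₁ p₂ ∘ κ {X} {Y} ≈ p₂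
  Sp₂-κ = begin
    S₁ p₂ ∘ κ                       ≈⟨ ∘-congʳ p₂-⟨⟩ ⟨
    (p₂ ∘ ⟨ S₁ p₁ , S₁ p₂ ⟩) ∘ κ    ≈⟨ assoc ⟩
    p₂ ∘ ⟨ S₁ p₁ , S₁ p₂ ⟩ ∘ κ      ≈⟨ ∘-congˡ (IsIso.invʳ S-&²) ⟩
    p₂ ∘ id                         ≈⟨ identityʳ ⟩
    p₂                              ∎

  -- Because `κ` is inverse to the pairing of `S₁ p₁` and `S₁ p₂`, these two maps are product
  -- projections out of `S₀ (X & Y)`. Equations between maps into that object are checked on them.
  κ-unique : {f : W ⟶ S₀ X} {g : W ⟶ S₀ Y} {h : W ⟶ S₀ (X & Y)} →
             S₁ p₁ ∘ h ≈ f → S₁ p₂ ∘ h ≈ g → h ≈ κ ∘ ⟨ f , g ⟩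
  κ-unique {f = f} {g} {h} p q = begin
    h                                   ≈⟨ identityˡ ⟨
    id ∘ h                              ≈⟨ pullˡ (IsIso.invˡ S-&²) ⟨
    κ ∘ ⟨ S₁ p₁ , S₁ p₂ ⟩ ∘ h           ≈⟨ ∘-congˡ ⟨⟩-∘ ⟩
    κ ∘ ⟨ S₁ p₁ ∘ h , S₁ p₂ ∘ h ⟩       ≈⟨ ∘-congˡ (⟨⟩-cong p q) ⟩
    κ ∘ ⟨ f , g ⟩                       ∎

  κ-&₁ : {u : X ⟶ X′} {v : Y ⟶ Y′} {f : W ⟶ S₀ X} {g : W ⟶ S₀ Y} →
         S₁ (u &₁ v) ∘ κ ∘ ⟨ f , g ⟩ ≈ κ ∘ ⟨ S₁ u ∘ f , S₁ v ∘ g ⟩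
  κ-&₁ {u = u} {v} {f} {g} = κ-unique
    (begin
      S₁ p₁ ∘ S₁ (u &₁ v) ∘ κ ∘ ⟨ f , g ⟩  ≈⟨ glue (S-square p₁-⟨⟩) ⟩
      S₁ u ∘ S₁ p₁ ∘ κ ∘ ⟨ f , g ⟩         ≈⟨ ∘-congˡ (pullˡ Sp₁-κ) ⟩
      S₁ u ∘ p₁ ∘ ⟨ f , g ⟩                ≈⟨ ∘-congˡ p₁-⟨⟩ ⟩
      S₁ u ∘ f                             ∎)
    (begin
      S₁ p₂ ∘ S₁ (u &₁ v) ∘ κ ∘ ⟨ f , g ⟩  ≈⟨ glue (S-square p₂-⟨⟩) ⟩
      S₁ v ∘ S₁ p₂ ∘ κ ∘ ⟨ f , g ⟩         ≈⟨ ∘-congˡ (pullˡ Sp₂-κ) ⟩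
      S₁ v ∘ p₂ ∘ ⟨ f , g ⟩                ≈⟨ ∘-congˡ p₂-⟨⟩ ⟩
      S₁ v ∘ g                             ∎)
    where
    S-square : ∀ {V V′ : Obj} {a : V ⟶ W} {b : X ⟶ V} {a′ : V′ ⟶ W} {b′ : X ⟶ V′} →
               a ∘ b ≈ a′ ∘ b′ → S₁ a ∘ S₁ b ≈ S₁ a′ ∘ S₁ b′
    S-square p = ≈-trans (≈-sym S-∘) (≈-trans (S-cong p) S-∘)

  -- Injecting by `ι₀` in the first component on the outer layer and in the second on the inner
  -- layer loses nothing after `θ`: the first projection collapses by `θ-ι₀`, the second by `θ-Sι₀`.
  θ-κ : {f : W ⟶ S₀ X} {g : W ⟶ S₀ Y} →
        θ ∘ S₁ (κ ∘ (id &₁ ι₀)) ∘ κ ∘ (ι₀ &₁ id) ∘ ⟨ f , g ⟩ ≈ κ ∘ ⟨ f , g ⟩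
  θ-κ {f = f} {g} = κ-unique
    (begin
      S₁ p₁ ∘ θ ∘ S₁ (κ ∘ (id &₁ ι₀)) ∘ κ ∘ (ι₀ &₁ id) ∘ ⟨ f , g ⟩
        ≈⟨ project Sp₁-κ p₁-⟨⟩ ⟩
      θ ∘ S₁ (id ∘ p₁) ∘ κ ∘ (ι₀ &₁ id) ∘ ⟨ f , g ⟩
        ≈⟨ ∘-congˡ (≈-trans (∘-congʳ (S-cong identityˡ)) (pullˡ Sp₁-κ)) ⟩
      θ ∘ p₁ ∘ (ι₀ &₁ id) ∘ ⟨ f , g ⟩
        ≈⟨ ∘-congˡ (≈-trans (∘-congˡ &₁-⟨⟩) p₁-⟨⟩) ⟩
      θ ∘ ι₀ ∘ f
        ≈⟨ ≈-trans (pullˡ θ-ι₀) identityˡ ⟩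
      f ∎)
    (begin
      S₁ p₂ ∘ θ ∘ S₁ (κ ∘ (id &₁ ι₀)) ∘ κ ∘ (ι₀ &₁ id) ∘ ⟨ f , g ⟩
        ≈⟨ project Sp₂-κ p₂-⟨⟩ ⟩
      θ ∘ S₁ (ι₀ ∘ p₂) ∘ κ ∘ (ι₀ &₁ id) ∘ ⟨ f , g ⟩
        ≈⟨ ∘-congˡ (≈-trans (∘-congʳ S-∘) (≈-trans assoc (∘-congˡ (pullˡ Sp₂-κ)))) ⟩
      θ ∘ S₁ ι₀ ∘ p₂ ∘ (ι₀ &₁ id) ∘ ⟨ f , g ⟩
        ≈⟨ ≈-trans (pullˡ θ-Sι₀) identityˡ ⟩
      p₂ ∘ (ι₀ &₁ id) ∘ ⟨ f , g ⟩
        ≈⟨ ≈-trans (∘-congˡ &₁-⟨⟩) (≈-trans p₂-⟨⟩ identityˡ) ⟩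
      g ∎)
    where
    -- Shared by both components: the projection moves past `θ` by naturality and then acts inside
    -- the inner layer.
    project : ∀ {V V₁ V₂ V₃ V₄ : Obj} {a : V₁ ⟶ V₂} {b : V₃ ⟶ S₀ V₁} {a′ : V₃ ⟶ S₀ V₂}
              {d : V₄ ⟶ V₃} {b′ : V₄ ⟶ S₀ V₂} {h : V ⟶ S₀ V₄} →
              S₁ a ∘ b ≈ a′ → a′ ∘ d ≈ b′ → S₁ a ∘ θ ∘ S₁ (b ∘ d) ∘ h ≈ θ ∘ S₁ b′ ∘ h
    project p q = ≈-trans (glue (≈-sym θ-natural))
      (∘-congˡ (pullˡ (≈-trans (≈-sym S-∘) (S-cong (≈-trans (pullˡ p) q)))))

  L-natural : {u : X ⟶ X′} {v : Y ⟶ Y′} → S₁ (u ⊗₁ v) ∘ L ≈ L ∘ (S₁ u ⊗₁ S₁ v)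
  L-natural {u = u} {v} = π-jointly-monic
    (begin
      π₀ ∘ S₁ (u ⊗₁ v) ∘ L              ≈⟨ glue π₀-natural ⟩
      (u ⊗₁ v) ∘ π₀ ∘ L                 ≈⟨ ∘-congˡ (π₀-⟪⟫ L-summable) ⟩
      (u ⊗₁ v) ∘ (π₀ ⊗₁ π₀)             ≈⟨ ⊗-square π₀-natural π₀-natural ⟩
      (π₀ ⊗₁ π₀) ∘ (S₁ u ⊗₁ S₁ v)       ≈⟨ pullˡ (π₀-⟪⟫ L-summable) ⟨
      π₀ ∘ L ∘ (S₁ u ⊗₁ S₁ v)           ∎)
    (begin
      π₁ ∘ S₁ (u ⊗₁ v) ∘ L              ≈⟨ glue π₁-natural ⟩
      (u ⊗₁ v) ∘ π₁ ∘ L                 ≈⟨ ∘-congˡ (π₁-⟪⟫ L-summable) ⟩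
      (u ⊗₁ v) ∘ sum L₁-summable        ≈⟨ glue σ-natural ⟨
      sum (Summable-∘ˡ (u ⊗₁ v) L₁-summable)
        ≈⟨ sum-cong (⊗-square π₁-natural π₀-natural) (⊗-square π₀-natural π₁-natural)
             (Summable-∘ˡ (u ⊗₁ v) L₁-summable) (Summable-∘ʳ L₁-summable (S₁ u ⊗₁ S₁ v)) ⟩
      sum (Summable-∘ʳ L₁-summable (S₁ u ⊗₁ S₁ v))
                                        ≈⟨ assoc ⟨
      sum L₁-summable ∘ (S₁ u ⊗₁ S₁ v)  ≈⟨ pullˡ (π₁-⟪⟫ L-summable) ⟨
      π₁ ∘ L ∘ (S₁ u ⊗₁ S₁ v)           ∎)
    where
    ⊗-square : ∀ {V V′ W W′ : Obj} {f : V ⟶ V′} {f′ : S₀ V ⟶ S₀ V′} {g : W ⟶ W′} {g′ : S₀ W ⟶ S₀ W′}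
               {a : S₀ V ⟶ V} {a′ : S₀ V′ ⟶ V′} {b : S₀ W ⟶ W} {b′ : S₀ W′ ⟶ W′} →
               a′ ∘ f′ ≈ f ∘ a → b′ ∘ g′ ≈ g ∘ b →
               (f ⊗₁ g) ∘ (a ⊗₁ b) ≈ (a′ ⊗₁ b′) ∘ (f′ ⊗₁ g′)
    ⊗-square p q = ≈-trans (≈-sym ⊗-∘) (≈-trans (⊗-cong (≈-sym p) (≈-sym q)) ⊗-∘)

  -- With no variation in the second factor, the summand `π₀ ⊗₁ π₁` of the Leibniz rule is zero.
  -- This lets `∂-&²`, stated with `L`, apply to `φ¹`.
  L-ι₀ : L {X} {Y} ∘ (id ⊗₁ ι₀) ≈ φ¹
  L-ι₀ = π-jointly-monic
    (begin
      π₀ ∘ L ∘ (id ⊗₁ ι₀)               ≈⟨ pullˡ (π₀-⟪⟫ L-summable) ⟩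
      (π₀ ⊗₁ π₀) ∘ (id ⊗₁ ι₀)           ≈⟨ ⊗-∘ ⟨
      (π₀ ∘ id) ⊗₁ (π₀ ∘ ι₀)            ≈⟨ ⊗-cong identityʳ π₀-ι₀ ⟩
      π₀ ⊗₁ id                          ≈⟨ π₀-⟪⟫ φ¹-summable ⟨
      π₀ ∘ φ¹                           ∎)
    (begin
      π₁ ∘ L ∘ (id ⊗₁ ι₀)               ≈⟨ pullˡ (π₁-⟪⟫ L-summable) ⟩
      sum L₁-summable ∘ (id ⊗₁ ι₀)      ≈⟨ assoc ⟩
      sum (Summable-∘ʳ L₁-summable (id ⊗₁ ι₀))
        ≈⟨ sum-0ʳ (≈-trans (≈-sym ⊗-∘) (≈-trans (⊗-cong ≈-refl π₁-ι₀) ⊗-0))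
             (Summable-∘ʳ L₁-summable (id ⊗₁ ι₀)) ⟩
      (π₁ ⊗₁ π₀) ∘ (id ⊗₁ ι₀)           ≈⟨ ⊗-∘ ⟨
      (π₁ ∘ id) ⊗₁ (π₀ ∘ ι₀)            ≈⟨ ⊗-cong identityʳ π₀-ι₀ ⟩
      π₁ ⊗₁ id                          ≈⟨ π₁-⟪⟫ φ¹-summable ⟨
      π₁ ∘ φ¹                           ∎)

-- The functor `D` on the Kleisli category.

module KleisliProperties (𝓛 : CoherentDifferentialResourceCategory o ℓ e) where
  open CoherentDifferentialResourceCategory 𝓛
  open Category category
  open CategoryProperties category
  open ZeroMorphisms zeroMorphisms
  open FiniteProducts products
  open ProductProperties products
  open ResourceModality resourceModality
  open SummabilityStructure summability
  open Summation summability
  open SummationProperties summability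
  open SummabilityCompatible compatible
  open CompatibilityProperties compatible
  open DifferentialStructure differential
  open Kleisli 𝓛

  private
    variable
      V W X Y Z : Obj

  ∘!-cong : {g g′ : X ⟶! Y} {f f′ : W ⟶! X} → g ≈ g′ → f ≈ f′ → g ∘! f ≈ g′ ∘! f′
  ∘!-cong p q = ∘-cong p (∘-congʳ (!-cong q))

  ∘!-assoc : {h : X ⟶! Y} {g : W ⟶! X} {f : V ⟶! W} → (h ∘! g) ∘! f ≈ h ∘! (g ∘! f)
  ∘!-assoc {h = h} {g} {f} = begin
    (h ∘ !₁ g ∘ dig) ∘ !₁ f ∘ dig                ≈⟨ ≈-trans assoc (∘-congˡ assoc) ⟩
    h ∘ !₁ g ∘ dig ∘ !₁ f ∘ dig                  ≈⟨ ∘-congˡ (∘-congˡ (glue dig-natural)) ⟩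
    h ∘ !₁ g ∘ !₁ (!₁ f) ∘ dig ∘ dig             ≈⟨ ∘-congˡ (∘-congˡ (∘-congˡ dig-dig)) ⟩
    h ∘ !₁ g ∘ !₁ (!₁ f) ∘ !₁ dig ∘ dig          ≈⟨ ∘-congˡ (∘-congˡ (pullˡ (≈-sym !-∘))) ⟩
    h ∘ !₁ g ∘ !₁ (!₁ f ∘ dig) ∘ dig             ≈⟨ ∘-congˡ (pullˡ (≈-sym !-∘)) ⟩
    h ∘ !₁ (g ∘ !₁ f ∘ dig) ∘ dig                ∎

  Der-∘! : {u : X ⟶ Y} {f : W ⟶! X} → Der u ∘! f ≈ u ∘ f
  Der-∘! {u = u} {f} = begin
    (u ∘ der) ∘ !₁ f ∘ dig      ≈⟨ assoc ⟩
    u ∘ der ∘ !₁ f ∘ dig        ≈⟨ ∘-congˡ (glue der-natural) ⟩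
    u ∘ f ∘ der ∘ dig           ≈⟨ ∘-congˡ (≈-trans (∘-congˡ der-dig) identityʳ) ⟩
    u ∘ f                       ∎

  D-cong : {f g : X ⟶! Y} → f ≈ g → D f ≈ D g
  D-cong p = ∘-congʳ (S-cong p)

  -- The chain rule: `∂-chain-dig` moves `∂` through `dig`, and naturality of `∂` moves it past `f`.
  D-∘! : {g : X ⟶! Y} {f : W ⟶! X} → D (g ∘! f) ≈ D g ∘! D f
  D-∘! {g = g} {f} = begin
    S₁ (g ∘ !₁ f ∘ dig) ∘ ∂                 ≈⟨ ∘-congʳ (≈-trans S-∘ (∘-congˡ S-∘)) ⟩
    (S₁ g ∘ S₁ (!₁ f) ∘ S₁ dig) ∘ ∂         ≈⟨ ≈-trans assoc (∘-congˡ assoc) ⟩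
    S₁ g ∘ S₁ (!₁ f) ∘ S₁ dig ∘ ∂           ≈⟨ ∘-congˡ (∘-congˡ ∂-chain-dig) ⟩
    S₁ g ∘ S₁ (!₁ f) ∘ ∂ ∘ !₁ ∂ ∘ dig       ≈⟨ ∘-congˡ (glue ∂-natural) ⟨
    S₁ g ∘ ∂ ∘ !₁ (S₁ f) ∘ !₁ ∂ ∘ dig       ≈⟨ ∘-congˡ (∘-congˡ (pullˡ (≈-sym !-∘))) ⟩
    S₁ g ∘ ∂ ∘ !₁ (S₁ f ∘ ∂) ∘ dig          ≈⟨ assoc ⟨
    (S₁ g ∘ ∂) ∘ !₁ (S₁ f ∘ ∂) ∘ dig        ∎

  D-!₁ : {f : X ⟶! Y} {u : W ⟶ X} → D (f ∘ !₁ u) ≈ D f ∘ !₁ (S₁ u)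
  D-!₁ = ≈-trans (∘-congʳ S-∘) (≈-trans assoc
    (≈-trans (∘-congˡ (≈-sym ∂-natural)) (≈-sym assoc)))

  -- Additivity of derivatives, in the form of naturality of `θ` with respect to `D`: `∂-add-θ`
  -- contracts the two uses of `∂` into one.
  θ-D-D : {f : X ⟶! Y} → θ ∘ D (D f) ≈ D f ∘ !₁ θ
  θ-D-D {f = f} = begin
    θ ∘ S₁ (S₁ f ∘ ∂) ∘ ∂           ≈⟨ ∘-congˡ (∘-congʳ S-∘) ⟩
    θ ∘ (S₁ (S₁ f) ∘ S₁ ∂) ∘ ∂      ≈⟨ ∘-congˡ assoc ⟩
    θ ∘ S₁ (S₁ f) ∘ S₁ ∂ ∘ ∂        ≈⟨ glue θ-natural ⟩
    S₁ f ∘ θ ∘ S₁ ∂ ∘ ∂             ≈⟨ ∘-congˡ ∂-add-θ ⟨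
    S₁ f ∘ ∂ ∘ !₁ θ                 ≈⟨ assoc ⟨
    (S₁ f ∘ ∂) ∘ !₁ θ               ∎

  D-⟨⟩ : {f : W ⟶! X} {g : W ⟶! Y} → D ⟨ f , g ⟩ ≈ κ ∘ ⟨ D f , D g ⟩
  D-⟨⟩ = κ-unique
    (pullˡ (≈-trans (≈-sym S-∘) (S-cong p₁-⟨⟩)))
    (pullˡ (≈-trans (≈-sym S-∘) (S-cong p₂-⟨⟩)))

  -- Both components of the pair depend on the varying argument, so `κ` joins their partial
  -- derivatives and the full derivative of `h` appears. It is applied with `h` equal to `Ev`, that
  -- is, to `step`.
  D₂-∘!-⟨⟩ : {h : X & Y ⟶! W} {f : V & Z ⟶! X} {g : V & Z ⟶! Y} →
             D₂ (h ∘! ⟨ f , g ⟩) ≈ D h ∘! (κ ∘ ⟨ D₂ f , D₂ g ⟩)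
  D₂-∘!-⟨⟩ {h = h} {f} {g} = begin
    D (h ∘! ⟨ f , g ⟩) ∘! ψ²          ≈⟨ ∘!-cong (≈-trans D-∘! (∘!-cong ≈-refl D-⟨⟩)) ≈-refl ⟩
    (D h ∘! (κ ∘ ⟨ D f , D g ⟩)) ∘! ψ²  ≈⟨ ∘!-assoc ⟩
    D h ∘! ((κ ∘ ⟨ D f , D g ⟩) ∘! ψ²)  ≈⟨ ∘!-cong ≈-refl (≈-trans assoc (∘-congˡ ⟨⟩-∘)) ⟩
    D h ∘! (κ ∘ ⟨ D₂ f , D₂ g ⟩)      ∎

  D₂-0 : D₂ (0⟶ { !₀ (V & X)} {Y}) ≈ 0⟶
  D₂-0 = ≈-trans (∘-congʳ (≈-trans (∘-congʳ S-0) 0-∘)) 0-∘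

-- Evaluation in the Kleisli category and its derivative.

module CartesianClosedProperties (𝓛 : CoherentDifferentialResourceCategory o ℓ e)
  (cl : Closed (CoherentDifferentialResourceCategory.monoidal 𝓛)) where
  open CoherentDifferentialResourceCategory 𝓛
  open Category category
  open CategoryProperties category
  open SymmetricMonoidal monoidal
  open FiniteProducts products
  open ProductProperties products
  open ResourceModality resourceModality
  open SummabilityStructure summability
  open Summation summability
  open SummationProperties summability
  open SummabilityCompatible compatible
  open Strength compatible
  open CompatibilityProperties compatible
  open DifferentialStructure differential
  open Kleisli 𝓛
  open KleisliProperties 𝓛
  open Closed cl
  open CartesianClosed 𝓛 cl

  private
    variable
      V W X X′ Y Y′ : Obj

    m²⁻¹ : !₀ (X & Y) ⟶ !₀ X ⊗ !₀ Y
    m²⁻¹ = IsIso.inv m²-iso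

  m²⁻¹-natural : {f : X ⟶ X′} {g : Y ⟶ Y′} →
                 m²⁻¹ ∘ !₁ (f &₁ g) ≈ (!₁ f ⊗₁ !₁ g) ∘ m²⁻¹
  m²⁻¹-natural {f = f} {g} = begin
    m²⁻¹ ∘ !₁ (f &₁ g)                      ≈⟨ ∘-congˡ identityʳ ⟨
    m²⁻¹ ∘ !₁ (f &₁ g) ∘ id                 ≈⟨ ∘-congˡ (∘-congˡ (IsIso.invʳ m²-iso)) ⟨
    m²⁻¹ ∘ !₁ (f &₁ g) ∘ m² ∘ m²⁻¹          ≈⟨ ∘-congˡ (glue m²-natural) ⟨
    m²⁻¹ ∘ m² ∘ (!₁ f ⊗₁ !₁ g) ∘ m²⁻¹       ≈⟨ pullˡ (IsIso.invˡ m²-iso) ⟩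
    id ∘ (!₁ f ⊗₁ !₁ g) ∘ m²⁻¹              ≈⟨ identityˡ ⟩
    (!₁ f ⊗₁ !₁ g) ∘ m²⁻¹                   ∎

  m²⁻¹-dig : m²⁻¹ ∘ !₁ ⟨ !₁ p₁ , !₁ p₂ ⟩ ∘ dig ≈ (dig ⊗₁ dig) ∘ m²⁻¹ {X} {Y}
  m²⁻¹-dig = begin
    m²⁻¹ ∘ !₁ ⟨ !₁ p₁ , !₁ p₂ ⟩ ∘ dig                   ≈⟨ ∘-congˡ identityʳ ⟨
    m²⁻¹ ∘ (!₁ ⟨ !₁ p₁ , !₁ p₂ ⟩ ∘ dig) ∘ id            ≈⟨ ∘-congˡ (∘-congˡ (IsIso.invʳ m²-iso)) ⟨
    m²⁻¹ ∘ (!₁ ⟨ !₁ p₁ , !₁ p₂ ⟩ ∘ dig) ∘ m² ∘ m²⁻¹     ≈⟨ ∘-congˡ (glue (≈-trans assoc m²-dig)) ⟩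
    m²⁻¹ ∘ m² ∘ (dig ⊗₁ dig) ∘ m²⁻¹                     ≈⟨ pullˡ (IsIso.invˡ m²-iso) ⟩
    id ∘ (dig ⊗₁ dig) ∘ m²⁻¹                            ≈⟨ identityˡ ⟩
    (dig ⊗₁ dig) ∘ m²⁻¹                                 ∎

  -- The beta law of the Kleisli exponential. The map `(Cur f &₁ der) ∘ ⟨ !₁ p₁ , !₁ p₂ ⟩` is the
  -- Kleisli product of `Cur f` with the identity `der`; the pair factors through it.
  Ev-Cur : {f : W & X ⟶! Y} {g : V ⟶! W} {h : V ⟶! X} →
           Ev ∘! ⟨ Cur f ∘! g , h ⟩ ≈ f ∘! ⟨ g , h ⟩
  Ev-Cur {f = f} {g} {h} = begin
    Ev ∘! ⟨ Cur f ∘! g , h ⟩                             ≈⟨ ∘!-cong ≈-refl decompose ⟨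
    Ev ∘! (((Cur f &₁ der) ∘ ⟨ !₁ p₁ , !₁ p₂ ⟩) ∘! ⟨ g , h ⟩) ≈⟨ ∘!-assoc ⟨
    (Ev ∘! ((Cur f &₁ der) ∘ ⟨ !₁ p₁ , !₁ p₂ ⟩)) ∘! ⟨ g , h ⟩ ≈⟨ ∘!-cong Ev-Cur-p ≈-refl ⟩
    f ∘! ⟨ g , h ⟩                                       ∎
    where
    decompose : ((Cur f &₁ der) ∘ ⟨ !₁ p₁ , !₁ p₂ ⟩) ∘! ⟨ g , h ⟩ ≈ ⟨ Cur f ∘! g , h ⟩
    decompose = begin
      ((Cur f &₁ der) ∘ ⟨ !₁ p₁ , !₁ p₂ ⟩) ∘ !₁ ⟨ g , h ⟩ ∘ dig
        ≈⟨ ∘-congʳ &₁-⟨⟩ ⟩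
      ⟨ Cur f ∘ !₁ p₁ , der ∘ !₁ p₂ ⟩ ∘ !₁ ⟨ g , h ⟩ ∘ dig
        ≈⟨ ⟨⟩-∘ ⟩
      ⟨ (Cur f ∘ !₁ p₁) ∘ !₁ ⟨ g , h ⟩ ∘ dig , (der ∘ !₁ p₂) ∘ !₁ ⟨ g , h ⟩ ∘ dig ⟩
        ≈⟨ ⟨⟩-cong
             (≈-trans assoc (∘-congˡ (pullˡ (≈-trans (≈-sym !-∘) (!-cong p₁-⟨⟩)))))
             (≈-trans assoc (≈-trans (∘-congˡ (pullˡ (≈-trans (≈-sym !-∘) (!-cong p₂-⟨⟩))))
               (≈-trans (glue der-natural) (≈-trans (∘-congˡ der-dig) identityʳ)))) ⟩
      ⟨ Cur f ∘! g , h ⟩ ∎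

    -- The two factors use different counit laws: `der-dig` on the left, `!der-dig` on the right.
    ⊗-der : ∀ {Z Z′ : Obj} {k : !₀ Z ⟶ Z′} →
            (der ⊗₁ id) ∘ (!₁ k ⊗₁ !₁ der) ∘ (dig ⊗₁ dig) ≈ k ⊗₁ id { !₀ X}
    ⊗-der {k = k} = begin
      (der ⊗₁ id) ∘ (!₁ k ⊗₁ !₁ der) ∘ (dig ⊗₁ dig)       ≈⟨ ∘-congˡ ⊗-∘ ⟨
      (der ⊗₁ id) ∘ ((!₁ k ∘ dig) ⊗₁ (!₁ der ∘ dig))      ≈⟨ ⊗-∘ ⟨
      (der ∘ !₁ k ∘ dig) ⊗₁ (id ∘ !₁ der ∘ dig)
        ≈⟨ ⊗-cong (≈-trans (glue der-natural) (≈-trans (∘-congˡ der-dig) identityʳ))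
                  (≈-trans identityˡ !der-dig) ⟩
      k ⊗₁ id                                             ∎

    Ev-Cur-p : Ev ∘! ((Cur f &₁ der) ∘ ⟨ !₁ p₁ , !₁ p₂ ⟩) ≈ f
    Ev-Cur-p = begin
      (ev ∘ (der ⊗₁ id) ∘ m²⁻¹) ∘ !₁ ((Cur f &₁ der) ∘ ⟨ !₁ p₁ , !₁ p₂ ⟩) ∘ dig
        ≈⟨ ≈-trans assoc (∘-congˡ assoc) ⟩
      ev ∘ (der ⊗₁ id) ∘ m²⁻¹ ∘ !₁ ((Cur f &₁ der) ∘ ⟨ !₁ p₁ , !₁ p₂ ⟩) ∘ dig
        ≈⟨ ∘-congˡ (∘-congˡ (∘-congˡ (≈-trans (∘-congʳ !-∘) assoc))) ⟩
      ev ∘ (der ⊗₁ id) ∘ m²⁻¹ ∘ !₁ (Cur f &₁ der) ∘ !₁ ⟨ !₁ p₁ , !₁ p₂ ⟩ ∘ dig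
        ≈⟨ ∘-congˡ (∘-congˡ (glue m²⁻¹-natural)) ⟩
      ev ∘ (der ⊗₁ id) ∘ (!₁ (Cur f) ⊗₁ !₁ der) ∘ m²⁻¹ ∘ !₁ ⟨ !₁ p₁ , !₁ p₂ ⟩ ∘ dig
        ≈⟨ ∘-congˡ (∘-congˡ (∘-congˡ m²⁻¹-dig)) ⟩
      ev ∘ (der ⊗₁ id) ∘ (!₁ (Cur f) ⊗₁ !₁ der) ∘ (dig ⊗₁ dig) ∘ m²⁻¹
        ≈⟨ ∘-congˡ (≈-trans (∘-congˡ (≈-sym assoc)) (pullˡ ⊗-der)) ⟩
      ev ∘ (Cur f ⊗₁ id) ∘ m²⁻¹
        ≈⟨ pullˡ cur-β ⟩
      (f ∘ m²) ∘ m²⁻¹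
        ≈⟨ ≈-trans assoc (≈-trans (∘-congˡ (IsIso.invʳ m²-iso)) identityʳ) ⟩
      f ∎

  ∂-κ : ∂ ∘ !₁ (κ {X} {Y}) ≈ S₁ m² ∘ L ∘ (∂ ⊗₁ ∂) ∘ m²⁻¹
  ∂-κ = begin
    ∂ ∘ !₁ κ                                  ≈⟨ ∘-congˡ identityʳ ⟨
    ∂ ∘ !₁ κ ∘ id                             ≈⟨ ∘-congˡ (∘-congˡ (IsIso.invʳ m²-iso)) ⟨
    ∂ ∘ !₁ κ ∘ m² ∘ m²⁻¹                      ≈⟨ ∘-congˡ assoc ⟨
    ∂ ∘ (!₁ κ ∘ m²) ∘ m²⁻¹                    ≈⟨ pullˡ ∂-&² ⟩
    (S₁ m² ∘ L ∘ (∂ ⊗₁ ∂)) ∘ m²⁻¹             ≈⟨ ≈-trans assoc (∘-congˡ assoc) ⟩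
    S₁ m² ∘ L ∘ (∂ ⊗₁ ∂) ∘ m²⁻¹               ∎

  -- Both sides express differentiation of `Ev` in its function argument alone, with the input held
  -- constant by `ι₀`. Since `Ev` is linear in the function up to `der`, only `φ¹` is seen on the
  -- left; `∂` has to be reintroduced to reach the right.
  Ev-φ⊸ : Ev ∘ !₁ (φ⊸ cl &₁ id) ≈ D (Ev {X} {Y}) ∘ !₁ (κ ∘ (id &₁ ι₀))
  Ev-φ⊸ = begin
    (ev ∘ (der ⊗₁ id) ∘ m²⁻¹) ∘ !₁ (φ⊸ cl &₁ id)
      ≈⟨ ≈-trans assoc (∘-congˡ (≈-trans assoc (∘-congˡ m²⁻¹-natural))) ⟩
    ev ∘ (der ⊗₁ id) ∘ (!₁ (φ⊸ cl) ⊗₁ !₁ id) ∘ m²⁻¹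
      ≈⟨ ∘-congˡ (glue (begin
           (der ⊗₁ id) ∘ (!₁ (φ⊸ cl) ⊗₁ !₁ id)  ≈⟨ ⊗-∘ ⟨
           (der ∘ !₁ (φ⊸ cl)) ⊗₁ (id ∘ !₁ id)   ≈⟨ ⊗-cong der-natural (∘-congˡ !-id) ⟩
           (φ⊸ cl ∘ der) ⊗₁ (id ∘ id)           ≈⟨ ⊗-∘ ⟩
           (φ⊸ cl ⊗₁ id) ∘ (der ⊗₁ id)          ∎)) ⟩
    ev ∘ (φ⊸ cl ⊗₁ id) ∘ (der ⊗₁ id) ∘ m²⁻¹
      ≈⟨ ≈-trans (pullˡ cur-β) assoc ⟩
    S₁ ev ∘ φ¹ ∘ (der ⊗₁ id) ∘ m²⁻¹
      ≈⟨ ∘-congˡ (≈-trans (∘-congʳ (≈-sym L-ι₀)) assoc) ⟩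
    S₁ ev ∘ L ∘ (id ⊗₁ ι₀) ∘ (der ⊗₁ id) ∘ m²⁻¹
      -- Here `∂` enters: `∂-chain-der` rewrites `der` as `S₁ der ∘ ∂`, and `∂-add-ι₀` rewrites `ι₀`
      -- as `∂ ∘ !₁ ι₀`. The factor `S₁ id` gives the shape needed by `L-natural`.
      ≈⟨ ∘-congˡ (∘-congˡ (glue ⊗-der-∂)) ⟩
    S₁ ev ∘ L ∘ (S₁ der ⊗₁ S₁ id) ∘ (∂ ⊗₁ (∂ ∘ !₁ ι₀)) ∘ m²⁻¹
      ≈⟨ ∘-congˡ (glue L-natural) ⟨
    S₁ ev ∘ S₁ (der ⊗₁ id) ∘ L ∘ (∂ ⊗₁ (∂ ∘ !₁ ι₀)) ∘ m²⁻¹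
      ≈⟨ ∘-congˡ (∘-congˡ (∘-congˡ (≈-trans (∘-congʳ ⊗-∂) assoc))) ⟩
    S₁ ev ∘ S₁ (der ⊗₁ id) ∘ L ∘ (∂ ⊗₁ ∂) ∘ (!₁ id ⊗₁ !₁ ι₀) ∘ m²⁻¹
      ≈⟨ ∘-congˡ (∘-congˡ (∘-congˡ (∘-congˡ m²⁻¹-natural))) ⟨
    S₁ ev ∘ S₁ (der ⊗₁ id) ∘ L ∘ (∂ ⊗₁ ∂) ∘ m²⁻¹ ∘ !₁ (id &₁ ι₀)
      -- The identity is expanded so that `S₁ m²` meets `L`, exposing the right-hand side of `∂-κ`,
      -- while `S₁ m²⁻¹` completes `S₁ Ev`.
      ≈⟨ ∘-congˡ (∘-congˡ (≈-trans (∘-congʳ Sm²⁻¹-Sm²) identityˡ)) ⟨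
    S₁ ev ∘ S₁ (der ⊗₁ id) ∘ (S₁ m²⁻¹ ∘ S₁ m²) ∘ L ∘ (∂ ⊗₁ ∂) ∘ m²⁻¹ ∘ !₁ (id &₁ ι₀)
      ≈⟨ ∘-congˡ (∘-congˡ assoc) ⟩
    S₁ ev ∘ S₁ (der ⊗₁ id) ∘ S₁ m²⁻¹ ∘ S₁ m² ∘ L ∘ (∂ ⊗₁ ∂) ∘ m²⁻¹ ∘ !₁ (id &₁ ι₀)
      ≈⟨ ∘-congˡ (∘-congˡ (∘-congˡ
           (≈-trans (pullˡ ∂-κ) (≈-trans assoc (∘-congˡ (≈-trans assoc (∘-congˡ assoc))))))) ⟨
    S₁ ev ∘ S₁ (der ⊗₁ id) ∘ S₁ m²⁻¹ ∘ ∂ ∘ !₁ κ ∘ !₁ (id &₁ ι₀)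
      ≈⟨ ∘-congˡ (∘-congˡ (∘-congˡ (∘-congˡ !-∘))) ⟨
    S₁ ev ∘ S₁ (der ⊗₁ id) ∘ S₁ m²⁻¹ ∘ ∂ ∘ !₁ (κ ∘ (id &₁ ι₀))
      ≈⟨ ≈-trans (∘-congʳ (≈-trans S-∘ (∘-congˡ S-∘))) (≈-trans assoc (∘-congˡ assoc)) ⟨
    S₁ (ev ∘ (der ⊗₁ id) ∘ m²⁻¹) ∘ ∂ ∘ !₁ (κ ∘ (id &₁ ι₀))
      ≈⟨ assoc ⟨
    D Ev ∘ !₁ (κ ∘ (id &₁ ι₀)) ∎
    where
    ⊗-der-∂ : (id ⊗₁ ι₀) ∘ (der ⊗₁ id) ≈ (S₁ der ⊗₁ S₁ id) ∘ (∂ {V} ⊗₁ (∂ {W} ∘ !₁ ι₀))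
    ⊗-der-∂ = begin
      (id ⊗₁ ι₀) ∘ (der ⊗₁ id)                  ≈⟨ ⊗-∘ ⟨
      (id ∘ der) ⊗₁ (ι₀ ∘ id)
        ≈⟨ ⊗-cong (≈-trans identityˡ (≈-sym ∂-chain-der))
             (≈-trans identityʳ (≈-trans (≈-sym ∂-add-ι₀)
               (≈-sym (≈-trans (∘-congʳ S-id) identityˡ)))) ⟩
      (S₁ der ∘ ∂) ⊗₁ (S₁ id ∘ ∂ ∘ !₁ ι₀)       ≈⟨ ⊗-∘ ⟩
      (S₁ der ⊗₁ S₁ id) ∘ (∂ ⊗₁ (∂ ∘ !₁ ι₀))    ∎

    ⊗-∂ : ∂ {V} ⊗₁ (∂ {W} ∘ !₁ ι₀) ≈ (∂ ⊗₁ ∂) ∘ (!₁ id ⊗₁ !₁ ι₀)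
    ⊗-∂ = ≈-trans
      (⊗-cong (≈-sym (≈-trans (∘-congˡ !-id) identityʳ)) ≈-refl) ⊗-∘

    Sm²⁻¹-Sm² : S₁ m²⁻¹ ∘ S₁ m² ≈ id {S₀ (!₀ V ⊗ !₀ W)}
    Sm²⁻¹-Sm² = ≈-trans (≈-sym S-∘) (≈-trans (S-cong (IsIso.invˡ m²-iso)) S-id)

  -- Computes the operator on the right of the theorem. Taking `a` and `b` to be `D₂ f` and `D₂ g`
  -- gives exactly the value that `D₂-∘!-⟨⟩` finds on the left.
  Ev-θ-𝒟-ψ : {a : W ⟶! D₀ (X ⇒ Y)} {b : W ⟶! D₀ X} →
             Ev ∘! ⟨ (D₀ X ⇒₁ θ!) ∘! 𝒟 ∘! ψ ∘! a , b ⟩ ≈ D Ev ∘! (κ ∘ ⟨ a , b ⟩)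
  Ev-θ-𝒟-ψ {X = X} {a = a} {b} = begin
    Ev ∘! ⟨ (D₀ X ⇒₁ θ!) ∘! 𝒟 ∘! ψ ∘! a , b ⟩
      ≈⟨ Ev-Cur ⟩
    (θ! ∘! Ev) ∘! ⟨ 𝒟 ∘! ψ ∘! a , b ⟩
      ≈⟨ ≈-trans ∘!-assoc Der-∘! ⟩
    θ ∘ (Ev ∘! ⟨ 𝒟 ∘! ψ ∘! a , b ⟩)
      ≈⟨ ∘-congˡ (≈-trans Ev-Cur ∘!-assoc) ⟩
    θ ∘ (D Ev ∘! (ψ² ∘! ⟨ ψ ∘! a , b ⟩))
      -- Both curryings are gone. Now `φ⊸` slides through `ι₀` and `κ` by naturality, so that it can
      -- be absorbed under `D`, next to `Ev`.
      ≈⟨ ∘-congˡ (∘!-cong ≈-refl ψ²-ψ) ⟩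
    θ ∘ (D Ev ∘! (S₁ (φ⊸ cl &₁ id) ∘ x))
      ≈⟨ ∘-congˡ (≈-sym D-φ) ⟩
    θ ∘ (D (Ev ∘ !₁ (φ⊸ cl &₁ id)) ∘! x)
      ≈⟨ ∘-congˡ (∘!-cong (≈-trans (D-cong Ev-φ⊸) D-!₁) ≈-refl) ⟩
    θ ∘ (D (D Ev) ∘ !₁ (S₁ (κ ∘ (id &₁ ι₀)))) ∘! x
      ≈⟨ ∘-congˡ !₁-∘! ⟩
    θ ∘ (D (D Ev) ∘! (S₁ (κ ∘ (id &₁ ι₀)) ∘ x))
      -- The second derivative of `Ev` contracts to a first one, and `θ` now acts on the argument,
      -- where `θ-κ` applies.
      ≈⟨ pullˡ θ-D-D ⟩
    (D Ev ∘ !₁ θ) ∘! (S₁ (κ ∘ (id &₁ ι₀)) ∘ x)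
      ≈⟨ !₁-∘! ⟩
    D Ev ∘! (θ ∘ S₁ (κ ∘ (id &₁ ι₀)) ∘ x)
      ≈⟨ ∘!-cong ≈-refl θ-κ ⟩
    D Ev ∘! (κ ∘ ⟨ a , b ⟩) ∎
    where
    x = κ ∘ (ι₀ &₁ id) ∘ ⟨ a , b ⟩

    !₁-∘! : ∀ {V₁ V₂ V₃ V₄ : Obj} {f : V₁ ⟶! V₂} {u : V₃ ⟶ V₁} {y : V₄ ⟶! V₃} →
            (f ∘ !₁ u) ∘! y ≈ f ∘! (u ∘ y)
    !₁-∘! = ≈-trans assoc (∘-congˡ (pullˡ (≈-sym !-∘)))

    D-φ : D (Ev ∘ !₁ (φ⊸ cl &₁ id)) ∘! x ≈ D Ev ∘! (S₁ (φ⊸ cl &₁ id) ∘ x)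
    D-φ = ≈-trans (∘!-cong D-!₁ ≈-refl) !₁-∘!

    ψ²-ψ : ψ² ∘! ⟨ ψ ∘! a , b ⟩ ≈ S₁ (φ⊸ cl &₁ id) ∘ x
    ψ²-ψ = begin
      ψ² ∘! ⟨ ψ ∘! a , b ⟩                                  ≈⟨ Der-∘! ⟩
      (κ ∘ (ι₀ &₁ id)) ∘ ⟨ ψ ∘! a , b ⟩                     ≈⟨ assoc ⟩
      κ ∘ (ι₀ &₁ id) ∘ ⟨ ψ ∘! a , b ⟩                       ≈⟨ ∘-congˡ &₁-⟨⟩ ⟩
      κ ∘ ⟨ ι₀ ∘ (ψ ∘! a) , id ∘ b ⟩
        ≈⟨ ∘-congˡ (⟨⟩-cong (≈-trans (∘-congˡ Der-∘!) (≈-sym (glue ι₀-natural)))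
             (≈-sym (≈-trans (∘-congʳ S-id) identityˡ))) ⟩
      κ ∘ ⟨ S₁ (φ⊸ cl) ∘ ι₀ ∘ a , S₁ id ∘ id ∘ b ⟩          ≈⟨ κ-&₁ ⟨
      S₁ (φ⊸ cl &₁ id) ∘ κ ∘ ⟨ ι₀ ∘ a , id ∘ b ⟩            ≈⟨ ∘-congˡ (∘-congˡ &₁-⟨⟩) ⟨
      S₁ (φ⊸ cl &₁ id) ∘ x                                  ∎

-- Lubs, approximants and the fixpoint.

module FixpointProperties (𝓛 : CoherentDifferentialResourceCategory o ℓ e)
  (cl : Closed (CoherentDifferentialResourceCategory.monoidal 𝓛)) (scott : Scott 𝓛) where
  open CoherentDifferentialResourceCategory 𝓛
  open Category category
  open CategoryProperties category
  open FiniteProducts products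
  open ProductProperties products
  open SummabilityStructure summability
  open Summation summability
  open SummationProperties summability
  open Kleisli 𝓛
  open KleisliProperties 𝓛
  open CartesianClosed 𝓛 cl
  open CartesianClosedProperties 𝓛 cl
  open Scott scott
  open Fixpoint 𝓛 cl scott

  private
    variable
      V W X Y : Obj

  ∘ˡ-lub : (k : X ⟶ W) {f : ℕ → Y ⟶ X} {f∞ : Y ⟶ X} →
           Monotone f → IsLub f f∞ → IsLub (λ n → k ∘ f n) (k ∘ f∞)
  ∘ˡ-lub k mono u = ∘-lub constant-Monotone mono constant-lub u

  ∘ʳ-lub : (k : W ⟶ Y) {f : ℕ → Y ⟶ X} {f∞ : Y ⟶ X} →
           Monotone f → IsLub f f∞ → IsLub (λ n → f n ∘ k) (f∞ ∘ k)
  ∘ʳ-lub k mono u = ∘-lub mono constant-Monotone u constant-lub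

  S-lub : {f : ℕ → X ⟶ Y} {f∞ : X ⟶ Y} →
          Monotone f → IsLub f f∞ → IsLub (λ n → S₁ (f n)) (S₁ f∞)
  S-lub {f = f} {f∞} mono u = lub-resp (π-jointly-monic (agree π₀ π₀-natural) (agree π₁ π₁-natural)) w
    where
    S-f-Monotone : Monotone (λ n → S₁ (f n))
    S-f-Monotone q = S-mono (mono q)

    -- Some lub exists because `S₁` is monotone; it remains to identify it with `S₁ f∞`.
    w = proj₂ (lub S-f-Monotone)

    -- Naturality turns `p ∘ S₁ (f n)` into `f n ∘ p`. Composition preserves lubs on either side, so
    -- both composites are lubs of the same sequence.
    agree : (p : ∀ {X} → S₀ X ⟶ X) → (∀ {X Y} {g : X ⟶ Y} → p ∘ S₁ g ≈ g ∘ p) →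
            p ∘ proj₁ (lub S-f-Monotone) ≈ p ∘ S₁ f∞
    agree p natural = ≈-trans
      (lub-unique (λ _ → natural) (∘ˡ-lub p S-f-Monotone w) (∘ʳ-lub p mono u))
      (≈-sym natural)

  D₂-lub : {f : ℕ → V & X ⟶! Y} {f∞ : V & X ⟶! Y} →
           Monotone f → IsLub f f∞ → IsLub (λ n → D₂ (f n)) (D₂ f∞)
  D₂-lub mono u = ∘ʳ-lub _ (λ q → ≤-∘ʳ _ (S-mono (mono q)))
    (∘ʳ-lub _ (λ q → S-mono (mono q)) (S-lub mono u))

  module _ {V X Y : Obj} (f : V & X ⟶! Y ⇒ Y) where
    D₂-transform : V & D₀ X ⟶! D₀ Y ⇒ D₀ Y
    D₂-transform = (D₀ Y ⇒₁ θ!) ∘! 𝒟 ∘! ψ ∘! D₂ f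

    D₂-step : (g : V & X ⟶! Y) → D₂ (step f g) ≈ step D₂-transform (D₂ g)
    D₂-step g = ≈-trans D₂-∘!-⟨⟩ (≈-sym Ev-θ-𝒟-ψ)

    D₂-fixₙ : ∀ n → D₂ (fixₙ f n) ≈ fixₙ D₂-transform n
    -- Both iterations start at zero, which `D₂` preserves because `S₁` does.
    D₂-fixₙ zero    = D₂-0
    D₂-fixₙ (suc n) = ≈-trans (D₂-step (fixₙ f n))
      (∘!-cong ≈-refl (⟨⟩-cong ≈-refl (D₂-fixₙ n)))

    D₂-fix : D₂ (fix f) ≈ fix D₂-transform
    D₂-fix = lub-unique D₂-fixₙ (D₂-lub (fixₙ-Monotone f) (fix-isLub f)) (fix-isLub D₂-transform)

mainTheorem3 : {o ℓ e : Level}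
    (𝓛 : CoherentDifferentialResourceCategory o ℓ e) →
    let open CoherentDifferentialResourceCategory 𝓛
        open Category category
        open FiniteProducts products
        open Kleisli 𝓛 in
    (closed : Closed monoidal) (scott : Scott 𝓛) →
    let open CartesianClosed 𝓛 closed
        open Fixpoint 𝓛 closed scott in
    {X Y Z : Obj} (f : Z & X ⟶! Y ⇒ Y) →
    D₂ (fix f) ≈ fix ((D₀ Y ⇒₁ θ!) ∘! 𝒟 ∘! ψ ∘! D₂ f)
mainTheorem3 𝓛 closed scott f = FixpointProperties.D₂-fix 𝓛 closed scott f
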